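{- Let $q$ be a prime power (of any characteristic) and $n>1$. Let $\omega_1,\dots,\omega_n$ be elements of an algebraic closure of $\mathbb F_q$ (not necessarily distinct) with $x^n-1=\prod_{i=1}^n(x-\omega_i)$. Let $L(x)=\sum_{i=0}^{n-1}a_ix^{q^i}$ be a nonzero $q$-linear polynomial with all $a_i\in\mathbb F_q$, and set $L^*(x)=\sum_{i=0}^{n-1}a_ix^i$. Suppose that, for some $0<r\le n$ (after suitably ordering the $\omega_i$), \[\gcd(L^*(x),x^n-1)=\prod_{i=r+1}^n(x-\omega_i),\] and let $G\in\mathbb F_q[x]$ be any polynomial with \[L^*(x)\equiv G(x)\prod_{i=r+1}^n(x-\omega_i)\pmod{x^n-1}\] (for instance $G=L^*/\gcd(L^*,x^n-1)$). Then $\operatorname{rank}M_L=r$ and $\det M_L^{(r)}=\prod_{j=1}^r\omega_j^{ -r}G(\omega_j)$. In particular, if $r=n$, then $\det M_L=\prod_{j=1}^nL^*(\omega_j)$.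
   Context: For $L(x)=\sum_{i=0}^{n-1}a_ix^{q^i}$, $M_L$ is the $n\times n$ matrix whose $(i,j)$ entry is $a_{(j-i)\bmod n}^{q^{i-1}}$; when all $a_i\in\mathbb F_q$ this is the circulant matrix with first row $a_0,a_1,\dots,a_{n-1}$, each subsequent row being the previous one shifted cyclically one place to the right. $M^{(k)}$ denotes the submatrix of $M$ formed by its first $k$ rows and first $k$ columns. -}

module Defs where

open import Level using (Level; _⊔_) renaming (suc to lsuc)
open import Algebra.Bundles using (CommutativeRing; RawRing)
open import Algebra.Morphism.Structures using (module RingMorphisms)
open import Data.Nat as ℕ using (ℕ; zero; suc; _∸_; _<_; _≤_)
open import Data.Nat.DivMod using (_mod_)
open import Data.Nat.Primality using (Prime)
open import Data.Fin as Fin using (Fin; toℕ; punchIn; inject≤)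
open import Data.List as List using (List; []; _∷_)
open import Data.Product using (Σ; ∃; ∃-syntax; _×_; _,_)
open import Relation.Nullary using (¬_)
open import Relation.Binary.PropositionalEquality using (_≡_)

IsPrimePower : ℕ → Set
IsPrimePower q = ∃[ p ] ∃[ k ] (Prime p × 1 ≤ k × q ≡ p ℕ.^ k)

-- Fields (not in the standard library): a commutative ring with 1 ≠ 0
-- and a (total) inversion operation that is a two-sided inverse on
-- nonzero elements (its value at 0 is irrelevant).

record Field (c ℓ : Level) : Set (lsuc (c ⊔ ℓ)) where
  field
    commutativeRing : CommutativeRing c ℓ
  open CommutativeRing commutativeRing public
  infix 8 _⁻¹
  field
    _⁻¹      : Carrier → Carrier
    ⁻¹-cong  : ∀ {x y} → x ≈ y → x ⁻¹ ≈ y ⁻¹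
    1≉0      : ¬ (1# ≈ 0#)
    inverseʳ : ∀ x → ¬ (x ≈ 0#) → x * x ⁻¹ ≈ 1#

module Ops {c ℓ} (R : CommutativeRing c ℓ) where
  open CommutativeRing R

  pow : Carrier → ℕ → Carrier
  pow x zero    = 1#
  pow x (suc k) = x * pow x k

  sumF : ∀ {k} → (Fin k → Carrier) → Carrier
  sumF {zero}  f = 0#
  sumF {suc k} f = f Fin.zero + sumF (λ i → f (Fin.suc i))

  prodF : ∀ {k} → (Fin k → Carrier) → Carrier
  prodF {zero}  f = 1#
  prodF {suc k} f = f Fin.zero * prodF (λ i → f (Fin.suc i))

  sign : ℕ → Carrier
  sign zero    = 1#
  sign (suc k) = - sign k

  Matrix : ℕ → ℕ → Set c
  Matrix m n = Fin m → Fin n → Carrier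

  det : ∀ {k} → Matrix k k → Carrier
  det {zero}  M = 1#
  det {suc k} M =
    sumF (λ j → sign (toℕ j) * (M Fin.zero j * det (λ i l → M (Fin.suc i) (punchIn j l))))

  leading : ∀ {n} (k : ℕ) → k ≤ n → Matrix n n → Matrix k k
  leading k k≤n M i j = M (inject≤ i k≤n) (inject≤ j k≤n)

  RowsIndependent : ∀ {m n k} → Matrix m n → (Fin k → Fin m) → Set (c ⊔ ℓ)
  RowsIndependent M s =
    ∀ (coef : Fin _ → Carrier) →
      (∀ col → sumF (λ t → coef t * M (s t) col) ≈ 0#) →
      ∀ t → coef t ≈ 0#

  HasRank : ∀ {m n} → Matrix m n → ℕ → Set (c ⊔ ℓ)
  HasRank {m} M r =
    (∃[ s ] RowsIndependent {k = r} M s) ×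
    (∀ (s : Fin (suc r) → Fin m) → ¬ RowsIndependent M s)

  Poly : Set c
  Poly = List Carrier

  coeff : Poly → ℕ → Carrier
  coeff []       k       = 0#
  coeff (a ∷ p)  zero    = a
  coeff (a ∷ p)  (suc k) = coeff p k

  _≈P_ : Poly → Poly → Set ℓ
  p ≈P p' = ∀ k → coeff p k ≈ coeff p' k

  _+P_ : Poly → Poly → Poly
  []      +P q       = q
  (a ∷ p) +P []      = a ∷ p
  (a ∷ p) +P (b ∷ q) = (a + b) ∷ (p +P q)

  -P_ : Poly → Poly
  -P p = List.map -_ p

  _-P_ : Poly → Poly → Poly
  p -P q = p +P (-P q)

  _*P_ : Poly → Poly → Poly
  []      *P q = []
  (a ∷ p) *P q = List.map (a *_) q +P (0# ∷ (p *P q))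

  constP : Carrier → Poly
  constP a = a ∷ []

  X : Poly
  X = 0# ∷ 1# ∷ []

  prodP : ∀ {k} → (Fin k → Poly) → Poly
  prodP {zero}  f = constP 1#
  prodP {suc k} f = f Fin.zero *P prodP (λ i → f (Fin.suc i))

  xⁿ-1 : ℕ → Poly
  xⁿ-1 zero    = constP 0#
  xⁿ-1 (suc n) = (- 1#) ∷ List.replicate n 0# List.++ (1# ∷ [])

  eval : Poly → Carrier → Carrier
  eval p x = List.foldr (λ a acc → a + x * acc) 0# p

  _∣P_ : Poly → Poly → Set (c ⊔ ℓ)
  d ∣P p = ∃[ e ] ((e *P d) ≈P p)

  _≡_[modP_] : Poly → Poly → Poly → Set (c ⊔ ℓ)
  p ≡ p' [modP m ] = m ∣P (p -P p')

  IsGCD : Poly → Poly → Poly → Set (c ⊔ ℓ)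
  IsGCD d p p' = d ∣P p × d ∣P p' × (∀ e → e ∣P p → e ∣P p' → e ∣P d)

module _ {c ℓ} (F : Field c ℓ) where
  open Field F

  HasSize : ℕ → Set (c ⊔ ℓ)
  HasSize q = Σ (Fin q → Carrier) λ enum →
    (∀ i j → enum i ≈ enum j → i ≡ j) × (∀ x → ∃[ i ] enum i ≈ x)

module _ {c ℓ c' ℓ'} (F : Field c ℓ) (K : Field c' ℓ') where
  private
    module F = Field F
    module K = Field K
    module OK = Ops K.commutativeRing

  IsRingHom : (F.Carrier → K.Carrier) → Set (c ⊔ ℓ ⊔ ℓ')
  IsRingHom = RingMorphisms.IsRingHomomorphism F.rawRing K.rawRing

  IsAlgebraicOver : (F.Carrier → K.Carrier) → Set (c ⊔ c' ⊔ ℓ')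
  IsAlgebraicOver ι = ∀ y → ∃[ d ] (1 ≤ d × Σ (Fin d → F.Carrier) λ a →
    K._≈_ (OK.pow y d K.+ OK.sumF (λ i → ι (a i) K.* OK.pow y (toℕ i))) K.0#)

  IsAlgebraicClosure : (F.Carrier → K.Carrier) → Set (c ⊔ c' ⊔ ℓ ⊔ ℓ')
  IsAlgebraicClosure ι = IsRingHom ι × IsAlgebraicOver ι × IsAlgClosed
    where
    IsAlgClosed : Set (c' ⊔ ℓ')
    IsAlgClosed = ∀ d → 1 ≤ d → (a : Fin d → K.Carrier) →
      ∃[ x ] K._≈_ (OK.pow x d K.+ OK.sumF (λ i → a i K.* OK.pow x (toℕ i))) K.0#

-- The matrix M_L of L(x) = Σ a_i x^{q^i}  (0-indexed rows/columns):
-- (M_L)_{ij} = a_{(j-i) mod n}^{q^i}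

diffMod : ∀ {n} → Fin n → Fin n → Fin n
diffMod {suc m} i j = ((toℕ j ℕ.+ suc m) ∸ toℕ i) mod suc m

module _ {c ℓ} (F : Field c ℓ) where
  open Field F
  open Ops commutativeRing

  M-L : (q : ℕ) → ∀ {n} → (Fin n → Carrier) → Matrix n n
  M-L q a i j = pow (a (diffMod i j)) (q ℕ.^ toℕ i)

  L* : ∀ {n} → (Fin n → Carrier) → Poly
  L* {n} a = List.tabulate a

-- indices r, r+1, …, n-1 of Fin n (i.e. r+1,…,n in 1-indexed notation)
upper : ∀ {n} (r : ℕ) → r ≤ n → Fin (n ∸ r) → Fin n
upper r r≤n t = Fin.cast (m+[n∸m]≡n r≤n) (r Fin.↑ʳ t)
  where open import Data.Nat.Properties using (m+[n∸m]≡n)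

{-# OPTIONS --safe #-}
-- Frobenius fixes F, so row i of M_L holds the coefficients of x^i L* modulo
-- z = x^n - 1. Regard the leading r × r minor as an alternating form φ of r
-- polynomials modulo z; then it is φ(x^i G D), i < r. Row operations turn
-- φ(x^i Q), i < m + 1, into φ(Q, x^i (x - ω) Q), i < m. Since
-- G = G(ω) + (x - ω) G₁, and the polynomials G₁ (x - ω) D lie in the span of the
-- other rows modulo z, roots can be removed one at a time:
-- φ(x^i G D) = ∏ G(ω_j) φ(x^i D). The last form is a triangular determinant with
-- diagonal D(0), and D(0) ∏ (- ω_j) = - 1 gives D(0)^r = ∏ ω_j^(- r).
--
-- The rank is read off over F: a combination of the first r rows that vanishes is a
-- polynomial of degree < r annihilating L* modulo z, which maximality of D forbids,
-- while all rows are multiples w D with deg w < r, so r + 1 of them are dependent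
-- by counting.
module Submission where

open import Defs
open import Data.Nat using (ℕ; _<_; _≤_)
open import Data.Fin using (Fin; inject≤)
open import Data.List using (map)
open import Data.Product using (_×_)
open import Relation.Nullary using (¬_)
open import Relation.Binary.PropositionalEquality using (_≡_)

open import Level using (_⊔_)
open import Algebra.Bundles using (CommutativeRing)
open import Algebra.Morphism.Structures using (module RingMorphisms)
open import Algebra.Structures using (IsCommutativeRing)
open import Data.Bool using (if_then_else_)
open import Data.Empty using (⊥-elim)
open import Data.Fin as Fin using (toℕ; punchIn)
open import Data.Fin.Permutation using (Permutation; permutation)
import Data.Fin.Properties as Finₚ
open import Data.List as List using ([]; _∷_)
import Data.List.Properties as Listₚ
open import Data.Nat as ℕ using (zero; suc; _∸_; z≤n; s≤s)
open import Data.Nat.DivMod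
  using (_mod_; _%_; m%n<n; [m+n]%n≡m%n; m<n⇒m%n≡m; %-distribˡ-+; m%n%n≡m%n; m≤n⇒[n∸m]%m≡n%m)
import Data.Nat.Properties as ℕₚ
open import Data.Product using (∃-syntax; _,_; proj₁; proj₂)
open import Data.Sum using (_⊎_; inj₁; inj₂)
open import Data.Unit.Polymorphic using (⊤; tt)
import Data.Vec.Functional as Vector
open import Function using (_∘_)
open import Relation.Binary.PropositionalEquality as ≡ using (_≢_)
open import Relation.Nullary using (Dec; contradiction; yes; no; does)
open import Relation.Nullary.Decidable using (map′)

-- Removing one linear factor at a time puts multiplication by G in triangular form instead,
-- whatever the multiplicities. Equality in K is not assumed decidable, so nothing over K may rest
-- on a test for zero: the minors are computed over an arbitrary commutative ring, with division by
-- linear factors only. Degrees of unknown polynomials are determined over F alone, where finiteness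
-- decides equality. Finiteness also bounds the rank from above by counting vectors, without any
-- elimination.

-- Finite sums, products and powers in a commutative ring.

module Sums {c ℓ} (R : CommutativeRing c ℓ) where
  open CommutativeRing R hiding (zero)
  open Ops R
  open import Relation.Binary.Reasoning.Setoid setoid
  open import Algebra.Properties.CommutativeSemigroup +-commutativeSemigroup
    using () renaming (interchange to +-interchange)
  open import Algebra.Properties.CommutativeSemigroup *-commutativeSemigroup
    using () renaming (interchange to *-interchange)

  sumF-cong : ∀ {k} {f g : Fin k → Carrier} → (∀ i → f i ≈ g i) → sumF f ≈ sumF g
  sumF-cong {zero}  e = refl
  sumF-cong {suc k} e = +-cong (e Fin.zero) (sumF-cong (λ i → e (Fin.suc i)))

  sumF-zero : ∀ {k} {f : Fin k → Carrier} → (∀ i → f i ≈ 0#) → sumF f ≈ 0#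
  sumF-zero {zero}  e = refl
  sumF-zero {suc k} e =
    trans (+-cong (e Fin.zero) (sumF-zero (λ i → e (Fin.suc i)))) (+-identityˡ 0#)

  sumF-+ : ∀ {k} (f g : Fin k → Carrier) → sumF (λ i → f i + g i) ≈ sumF f + sumF g
  sumF-+ {zero}  f g = sym (+-identityˡ 0#)
  sumF-+ {suc k} f g =
    trans (+-congˡ (sumF-+ (λ i → f (Fin.suc i)) (λ i → g (Fin.suc i)))) (+-interchange _ _ _ _)

  *-sumF : ∀ {k} a (f : Fin k → Carrier) → a * sumF f ≈ sumF (λ i → a * f i)
  *-sumF {zero}  a f = zeroʳ a
  *-sumF {suc k} a f = trans (distribˡ a _ _) (+-congˡ (*-sumF a (λ i → f (Fin.suc i))))

  sumF-single : ∀ {k} (f : Fin k → Carrier) i → (∀ j → j ≢ i → f j ≈ 0#) → sumF f ≈ f i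
  sumF-single {suc k} f Fin.zero    e =
    trans (+-congˡ (sumF-zero (λ j → e (Fin.suc j) λ ()))) (+-identityʳ _)
  sumF-single {suc k} f (Fin.suc i) e =
    trans (+-cong (e Fin.zero λ ())
      (sumF-single _ i (λ j j≢i → e (Fin.suc j) (λ { ≡.refl → j≢i ≡.refl }))))
      (+-identityˡ _)

  prodF-cong : ∀ {k} {f g : Fin k → Carrier} → (∀ i → f i ≈ g i) → prodF f ≈ prodF g
  prodF-cong {zero}  e = refl
  prodF-cong {suc k} e = *-cong (e Fin.zero) (prodF-cong (λ i → e (Fin.suc i)))

  prodF-* : ∀ {k} (f g : Fin k → Carrier) → prodF (λ i → f i * g i) ≈ prodF f * prodF g
  prodF-* {zero}  f g = sym (*-identityˡ 1#)
  prodF-* {suc k} f g =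
    trans (*-congˡ (prodF-* (λ i → f (Fin.suc i)) (λ i → g (Fin.suc i)))) (*-interchange _ _ _ _)

  prodF-one : ∀ {k} {f : Fin k → Carrier} → (∀ i → f i ≈ 1#) → prodF f ≈ 1#
  prodF-one {zero}  e = refl
  prodF-one {suc k} e =
    trans (*-cong (e Fin.zero) (prodF-one (λ i → e (Fin.suc i)))) (*-identityˡ 1#)

  prodF-zero : ∀ {k} (f : Fin k → Carrier) i → f i ≈ 0# → prodF f ≈ 0#
  prodF-zero f Fin.zero    e = trans (*-congʳ e) (zeroˡ _)
  prodF-zero f (Fin.suc i) e = trans (*-congˡ (prodF-zero _ i e)) (zeroʳ _)

  prodF-const : ∀ k a → prodF {k} (λ _ → a) ≈ pow a k
  prodF-const zero    a = refl
  prodF-const (suc k) a = *-congˡ (prodF-const k a)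

  pow-cong : ∀ {x y} k → x ≈ y → pow x k ≈ pow y k
  pow-cong zero    e = refl
  pow-cong (suc k) e = *-cong e (pow-cong k e)

  pow-* : ∀ x y k → pow (x * y) k ≈ pow x k * pow y k
  pow-* x y zero    = sym (*-identityˡ 1#)
  pow-* x y (suc k) = trans (*-congˡ (pow-* x y k)) (*-interchange _ _ _ _)

  pow-one : ∀ k → pow 1# k ≈ 1#
  pow-one zero    = refl
  pow-one (suc k) = trans (*-identityˡ _) (pow-one k)

  pow-prodF : ∀ {k} (f : Fin k → Carrier) m → pow (prodF f) m ≈ prodF (λ i → pow (f i) m)
  pow-prodF {zero}  f m = pow-one m
  pow-prodF {suc k} f m = trans (pow-* _ _ m) (*-congˡ (pow-prodF (λ i → f (Fin.suc i)) m))

  prodF-split : ∀ {n r} (r≤n : r ≤ n) (f : Fin n → Carrier) →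
    prodF f ≈ prodF (λ i → f (inject≤ i r≤n)) * prodF (λ t → f (upper r r≤n t))
  -- For `r` = 0 the index map `upper` is a bare `cast`, identified with the identity by comparing
  -- `toℕ`; for `suc r` it commutes with `Fin.suc` by computation.
  prodF-split {n} {zero} r≤n f = trans
    (prodF-cong {f = f} {λ t → f (upper 0 r≤n t)}
      (λ t → reflexive (≡.cong f (≡.sym (Finₚ.toℕ-injective (Finₚ.toℕ-cast _ t))))))
    (sym (*-identityˡ _))
  prodF-split {suc n} {suc r} (s≤s r≤n) f =
    trans (*-congˡ (prodF-split r≤n (f ∘ Fin.suc))) (sym (*-assoc _ _ _))

-- Coefficient lists as a commutative ring.

module Polynomials {c ℓ} (R : CommutativeRing c ℓ) where
  open CommutativeRing R hiding (zero)
  open Ops R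
  open import Relation.Binary.Reasoning.Setoid setoid
  open import Algebra.Properties.Ring ring using (-0#≈0#)
  open import Algebra.Solver.Ring.NaturalCoefficients.Default commutativeSemiring
    using (solve; _:+_; _:*_; _:=_)

  infix 4 _≋_
  -- A record around `_≈P_`: the bare relation unfolds to a function type from which unification
  -- cannot recover the two lists.
  record _≋_ (p q : Poly) : Set ℓ where
    constructor coeffwise
    field at : p ≈P q
  open _≋_ public

  private
    tail : Poly → Poly
    tail = List.drop 1

  coeff-tail : ∀ p k → coeff (tail p) k ≈ coeff p (suc k)
  coeff-tail []      k = refl
  coeff-tail (a ∷ p) k = refl

  coeff-+P : ∀ p q k → coeff (p +P q) k ≈ coeff p k + coeff q k
  coeff-+P []      q       k       = sym (+-identityˡ _)
  coeff-+P (a ∷ p) []      k       = sym (+-identityʳ _)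
  coeff-+P (a ∷ p) (b ∷ q) zero    = refl
  coeff-+P (a ∷ p) (b ∷ q) (suc k) = coeff-+P p q k

  coeff-scale : ∀ a p k → coeff (List.map (a *_) p) k ≈ a * coeff p k
  coeff-scale a []      k       = sym (zeroʳ a)
  coeff-scale a (b ∷ p) zero    = refl
  coeff-scale a (b ∷ p) (suc k) = coeff-scale a p k

  coeff--P : ∀ p k → coeff (-P p) k ≈ - coeff p k
  coeff--P []      k       = sym -0#≈0#
  coeff--P (b ∷ p) zero    = refl
  coeff--P (b ∷ p) (suc k) = coeff--P p k

  coeff-*P-zero : ∀ p q → coeff (p *P q) 0 ≈ coeff p 0 * coeff q 0
  coeff-*P-zero []      q = sym (zeroˡ _)
  coeff-*P-zero (a ∷ p) q =
    trans (coeff-+P (List.map (a *_) q) _ 0) (trans (+-identityʳ _) (coeff-scale a q 0))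

  -- Phrased with `tail` instead of cases on the list, so that the product laws go by induction on
  -- the coefficient index. Lists that differ only by trailing zeros then cause no extra cases.
  coeff-*P-suc : ∀ p q k →
    coeff (p *P q) (suc k) ≈ coeff p 0 * coeff q (suc k) + coeff (tail p *P q) k
  coeff-*P-suc []      q k = sym (trans (+-identityʳ _) (zeroˡ _))
  coeff-*P-suc (a ∷ p) q k =
    trans (coeff-+P (List.map (a *_) q) _ (suc k)) (+-congʳ (coeff-scale a q (suc k)))

  private
    *P-cong : ∀ p p′ q q′ → p ≈P p′ → q ≈P q′ → (p *P q) ≈P (p′ *P q′)
    *P-cong p p′ q q′ e f zero =
      trans (coeff-*P-zero p q) (trans (*-cong (e 0) (f 0)) (sym (coeff-*P-zero p′ q′)))
    *P-cong p p′ q q′ e f (suc k) =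
      trans (coeff-*P-suc p q k) (trans
        (+-cong (*-cong (e 0) (f (suc k)))
          (*P-cong (tail p) (tail p′) q q′
            (λ j → trans (coeff-tail p j) (trans (e (suc j)) (sym (coeff-tail p′ j)))) f k))
        (sym (coeff-*P-suc p′ q′ k)))

    +P-cong : ∀ p p′ q q′ → p ≈P p′ → q ≈P q′ → (p +P q) ≈P (p′ +P q′)
    +P-cong p p′ q q′ e f k =
      trans (coeff-+P p q k) (trans (+-cong (e k) (f k)) (sym (coeff-+P p′ q′ k)))

    *P-distribˡ : ∀ p q r → (p *P (q +P r)) ≈P ((p *P q) +P (p *P r))
    *P-distribˡ p q r zero = begin
      coeff (p *P (q +P r)) 0                     ≈⟨ coeff-*P-zero p _ ⟩
      coeff p 0 * coeff (q +P r) 0                ≈⟨ *-congˡ (coeff-+P q r 0) ⟩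
      coeff p 0 * (coeff q 0 + coeff r 0)         ≈⟨ distribˡ _ _ _ ⟩
      coeff p 0 * coeff q 0 + coeff p 0 * coeff r 0
        ≈⟨ +-cong (coeff-*P-zero p q) (coeff-*P-zero p r) ⟨
      coeff (p *P q) 0 + coeff (p *P r) 0         ≈⟨ coeff-+P (p *P q) _ 0 ⟨
      coeff ((p *P q) +P (p *P r)) 0              ∎
    *P-distribˡ p q r (suc k) = begin
      coeff (p *P (q +P r)) (suc k)               ≈⟨ coeff-*P-suc p _ k ⟩
      coeff p 0 * coeff (q +P r) (suc k) + coeff (tail p *P (q +P r)) k
        ≈⟨ +-cong (*-congˡ (coeff-+P q r (suc k)))
             (trans (*P-distribˡ (tail p) q r k) (coeff-+P (tail p *P q) _ k)) ⟩
      coeff p 0 * (coeff q (suc k) + coeff r (suc k))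
        + (coeff (tail p *P q) k + coeff (tail p *P r) k)
        ≈⟨ solve 5 (λ a b c d e → a :* (b :+ c) :+ (d :+ e) := (a :* b :+ d) :+ (a :* c :+ e))
             refl _ _ _ _ _ ⟩
      (coeff p 0 * coeff q (suc k) + coeff (tail p *P q) k)
        + (coeff p 0 * coeff r (suc k) + coeff (tail p *P r) k)
        ≈⟨ +-cong (coeff-*P-suc p q k) (coeff-*P-suc p r k) ⟨
      coeff (p *P q) (suc k) + coeff (p *P r) (suc k)  ≈⟨ coeff-+P (p *P q) _ (suc k) ⟨
      coeff ((p *P q) +P (p *P r)) (suc k)             ∎

    -- `_*P_` recurses on its left factor only; this is the mirror recursion on the right factor,
    -- from which commutativity follows.
    coeff-*P-sucʳ : ∀ p q k →
      coeff (p *P q) (suc k) ≈ coeff p (suc k) * coeff q 0 + coeff (p *P tail q) k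
    coeff-*P-sucʳ p q zero = begin
      coeff (p *P q) 1                                    ≈⟨ coeff-*P-suc p q 0 ⟩
      coeff p 0 * coeff q 1 + coeff (tail p *P q) 0       ≈⟨ +-congˡ (coeff-*P-zero (tail p) q) ⟩
      coeff p 0 * coeff q 1 + coeff (tail p) 0 * coeff q 0
        ≈⟨ +-cong (*-congˡ (sym (coeff-tail q 0))) (*-congʳ (coeff-tail p 0)) ⟩
      coeff p 0 * coeff (tail q) 0 + coeff p 1 * coeff q 0  ≈⟨ +-comm _ _ ⟩
      coeff p 1 * coeff q 0 + coeff p 0 * coeff (tail q) 0
        ≈⟨ +-congˡ (coeff-*P-zero p (tail q)) ⟨
      coeff p 1 * coeff q 0 + coeff (p *P tail q) 0         ∎
    coeff-*P-sucʳ p q (suc k) = begin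
      coeff (p *P q) (suc (suc k))                          ≈⟨ coeff-*P-suc p q (suc k) ⟩
      coeff p 0 * coeff q (suc (suc k)) + coeff (tail p *P q) (suc k)
        ≈⟨ +-cong (*-congˡ (sym (coeff-tail q (suc k)))) (trans (coeff-*P-sucʳ (tail p) q k)
             (+-congʳ (*-congʳ (coeff-tail p (suc k))))) ⟩
      coeff p 0 * coeff (tail q) (suc k)
        + (coeff p (suc (suc k)) * coeff q 0 + coeff (tail p *P tail q) k)
        ≈⟨ solve 3 (λ a b c → a :+ (b :+ c) := b :+ (a :+ c)) refl _ _ _ ⟩
      coeff p (suc (suc k)) * coeff q 0
        + (coeff p 0 * coeff (tail q) (suc k) + coeff (tail p *P tail q) k)
        ≈⟨ +-congˡ (coeff-*P-suc p (tail q) k) ⟨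
      coeff p (suc (suc k)) * coeff q 0 + coeff (p *P tail q) (suc k)  ∎

    *P-comm : ∀ p q → (p *P q) ≈P (q *P p)
    *P-comm p q zero = trans (coeff-*P-zero p q) (trans (*-comm _ _) (sym (coeff-*P-zero q p)))
    *P-comm p q (suc k) = trans (coeff-*P-suc p q k) (trans
      (+-cong (*-comm _ _) (*P-comm (tail p) q k)) (sym (coeff-*P-sucʳ q p k)))

    *P-distribʳ : ∀ p q r → ((q +P r) *P p) ≈P ((q *P p) +P (r *P p))
    *P-distribʳ p q r k = trans (*P-comm (q +P r) p k) (trans (*P-distribˡ p q r k)
      (+P-cong (p *P q) (q *P p) (p *P r) (r *P p) (*P-comm p q) (*P-comm p r) k))

    scale-*P : ∀ a p q k → coeff (List.map (a *_) p *P q) k ≈ a * coeff (p *P q) k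
    scale-*P a p q zero = begin
      coeff (List.map (a *_) p *P q) 0         ≈⟨ coeff-*P-zero (List.map (a *_) p) q ⟩
      coeff (List.map (a *_) p) 0 * coeff q 0  ≈⟨ *-congʳ (coeff-scale a p 0) ⟩
      a * coeff p 0 * coeff q 0                ≈⟨ *-assoc _ _ _ ⟩
      a * (coeff p 0 * coeff q 0)              ≈⟨ *-congˡ (coeff-*P-zero p q) ⟨
      a * coeff (p *P q) 0                     ∎
    scale-*P a p q (suc k) = begin
      coeff (List.map (a *_) p *P q) (suc k)   ≈⟨ coeff-*P-suc (List.map (a *_) p) q k ⟩
      coeff (List.map (a *_) p) 0 * coeff q (suc k) + coeff (tail (List.map (a *_) p) *P q) k
        ≈⟨ +-cong (*-congʳ (coeff-scale a p 0)) (trans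
             (*P-cong (tail (List.map (a *_) p)) (List.map (a *_) (tail p)) q q
               (tail-scale p) (λ _ → refl) k)
             (scale-*P a (tail p) q k)) ⟩
      a * coeff p 0 * coeff q (suc k) + a * coeff (tail p *P q) k
        ≈⟨ solve 4 (λ a b c d → a :* b :* c :+ a :* d := a :* (b :* c :+ d)) refl _ _ _ _ ⟩
      a * (coeff p 0 * coeff q (suc k) + coeff (tail p *P q) k)
        ≈⟨ *-congˡ (coeff-*P-suc p q k) ⟨
      a * coeff (p *P q) (suc k)               ∎
      where
      tail-scale : ∀ p → tail (List.map (a *_) p) ≈P List.map (a *_) (tail p)
      tail-scale []      k = refl
      tail-scale (_ ∷ _) k = refl

    *P-assoc : ∀ p q r → ((p *P q) *P r) ≈P (p *P (q *P r))
    *P-assoc p q r zero = begin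
      coeff ((p *P q) *P r) 0             ≈⟨ coeff-*P-zero (p *P q) r ⟩
      coeff (p *P q) 0 * coeff r 0        ≈⟨ *-congʳ (coeff-*P-zero p q) ⟩
      coeff p 0 * coeff q 0 * coeff r 0   ≈⟨ *-assoc _ _ _ ⟩
      coeff p 0 * (coeff q 0 * coeff r 0) ≈⟨ *-congˡ (coeff-*P-zero q r) ⟨
      coeff p 0 * coeff (q *P r) 0        ≈⟨ coeff-*P-zero p (q *P r) ⟨
      coeff (p *P (q *P r)) 0             ∎
    *P-assoc p q r (suc k) = begin
      coeff ((p *P q) *P r) (suc k)       ≈⟨ coeff-*P-suc (p *P q) r k ⟩
      coeff (p *P q) 0 * coeff r (suc k) + coeff (tail (p *P q) *P r) k
        ≈⟨ +-cong (*-congʳ (coeff-*P-zero p q)) (trans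
             (*P-cong (tail (p *P q)) (List.map (coeff p 0 *_) (tail q) +P (tail p *P q)) r r
               tail-* (λ _ → refl) k)
             (trans (*P-distribʳ r (List.map (coeff p 0 *_) (tail q)) (tail p *P q) k)
             (trans (coeff-+P (List.map (coeff p 0 *_) (tail q) *P r) _ k)
               (+-cong (scale-*P _ (tail q) r k) (*P-assoc (tail p) q r k))))) ⟩
      coeff p 0 * coeff q 0 * coeff r (suc k)
        + (coeff p 0 * coeff (tail q *P r) k + coeff (tail p *P (q *P r)) k)
        ≈⟨ solve 5 (λ a b c d e → a :* b :* c :+ (a :* d :+ e) := a :* (b :* c :+ d) :+ e)
             refl _ _ _ _ _ ⟩
      coeff p 0 * (coeff q 0 * coeff r (suc k) + coeff (tail q *P r) k)
        + coeff (tail p *P (q *P r)) k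
        ≈⟨ +-congʳ (*-congˡ (coeff-*P-suc q r k)) ⟨
      coeff p 0 * coeff (q *P r) (suc k) + coeff (tail p *P (q *P r)) k
        ≈⟨ coeff-*P-suc p (q *P r) k ⟨
      coeff (p *P (q *P r)) (suc k)       ∎
      where
      tail-* : tail (p *P q) ≈P (List.map (coeff p 0 *_) (tail q) +P (tail p *P q))
      tail-* j = begin
        coeff (tail (p *P q)) j    ≈⟨ coeff-tail (p *P q) j ⟩
        coeff (p *P q) (suc j)     ≈⟨ coeff-*P-suc p q j ⟩
        coeff p 0 * coeff q (suc j) + coeff (tail p *P q) j
          ≈⟨ +-congʳ (trans (coeff-scale _ (tail q) j) (*-congˡ (coeff-tail q j))) ⟨
        coeff (List.map (coeff p 0 *_) (tail q)) j + coeff (tail p *P q) j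
          ≈⟨ coeff-+P (List.map (coeff p 0 *_) (tail q)) _ j ⟨
        coeff (List.map (coeff p 0 *_) (tail q) +P (tail p *P q)) j ∎

    *P-identityˡ : ∀ p → (constP 1# *P p) ≈P p
    *P-identityˡ p zero    = trans (coeff-*P-zero (constP 1#) p) (*-identityˡ _)
    *P-identityˡ p (suc k) =
      trans (coeff-*P-suc (constP 1#) p k) (trans (+-identityʳ _) (*-identityˡ _))

  infixl 6 _⊕_
  infixl 7 _⊗_
  infix  8 ⊖_

  -- Opaque copies of the list operations, so that unification sees them as rigid.
  opaque
    _⊕_ _⊗_ : Poly → Poly → Poly
    _⊕_ = _+P_
    _⊗_ = _*P_

    ⊖_ : Poly → Poly
    ⊖_ = -P_

    𝟘 𝟙 : Poly
    𝟘 = []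
    𝟙 = constP 1#

  opaque
    unfolding _⊕_

    ⊕≡+P : ∀ p q → p ⊕ q ≡ p +P q
    ⊕≡+P p q = ≡.refl

    ⊗≡*P : ∀ p q → p ⊗ q ≡ p *P q
    ⊗≡*P p q = ≡.refl

    ⊖≡-P : ∀ p → ⊖ p ≡ -P p
    ⊖≡-P p = ≡.refl

    𝟘≡[] : 𝟘 ≡ []
    𝟘≡[] = ≡.refl

    𝟙≡1 : 𝟙 ≡ constP 1#
    𝟙≡1 = ≡.refl

    coeff-⊕ : ∀ p q k → coeff (p ⊕ q) k ≈ coeff p k + coeff q k
    coeff-⊕ = coeff-+P

    coeff-⊖ : ∀ p k → coeff (⊖ p) k ≈ - coeff p k
    coeff-⊖ = coeff--P

    isCommutativeRing-poly : IsCommutativeRing _≋_ _⊕_ _⊗_ ⊖_ 𝟘 𝟙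
    isCommutativeRing-poly = record
      { isRing = record
        { +-isAbelianGroup = record
          { isGroup = record
            { isMonoid = record
              { isSemigroup = record
                { isMagma = record
                  { isEquivalence = record
                    { refl  = coeffwise (λ _ → refl)
                    ; sym   = λ e → coeffwise (λ k → sym (at e k))
                    ; trans = λ e f → coeffwise (λ k → trans (at e k) (at f k)) }
                  ; ∙-cong = λ {p} {p′} {q} {q′} e f → coeffwise (+P-cong p p′ q q′ (at e) (at f)) }
                ; assoc = λ p q r → coeffwise (λ k →
                    trans (coeff-+P (p +P q) r k) (trans (+-congʳ (coeff-+P p q k))
                    (trans (+-assoc _ _ _) (sym (trans (coeff-+P p (q +P r) k)
                    (+-congˡ (coeff-+P q r k))))))) }
              ; identity = (λ p → coeffwise (λ k → refl))
                         , (λ p → coeffwise (λ k → trans (coeff-+P p [] k) (+-identityʳ _))) }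
            ; inverse = (λ p → coeffwise (λ k →
                            trans (coeff-+P (-P p) p k) (trans (+-congʳ (coeff--P p k)) (-‿inverseˡ _))))
                      , (λ p → coeffwise (λ k →
                            trans (coeff-+P p (-P p) k) (trans (+-congˡ (coeff--P p k)) (-‿inverseʳ _))))
            ; ⁻¹-cong = λ {p} {q} e → coeffwise (λ k →
                trans (coeff--P p k) (trans (-‿cong (at e k)) (sym (coeff--P q k)))) }
          ; comm = λ p q → coeffwise (λ k →
              trans (coeff-+P p q k) (trans (+-comm _ _) (sym (coeff-+P q p k)))) }
        ; *-cong = λ {p} {p′} {q} {q′} e f → coeffwise (*P-cong p p′ q q′ (at e) (at f))
        ; *-assoc = λ p q r → coeffwise (*P-assoc p q r)
        ; *-identity = (λ p → coeffwise (*P-identityˡ p))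
                     , (λ p → coeffwise (λ k → trans (*P-comm p (constP 1#) k) (*P-identityˡ p k)))
        ; distrib = (λ p q r → coeffwise (*P-distribˡ p q r))
                  , (λ p q r → coeffwise (*P-distribʳ p q r)) }
      ; *-comm = λ p q → coeffwise (*P-comm p q) }

  -- As a bundle, polynomials can serve as scalars for the ring solver and for `Ops` and `Sums`.
  polyRing : CommutativeRing c ℓ
  polyRing = record { isCommutativeRing = isCommutativeRing-poly }

  prodP≡prodF : ∀ {k} (f : Fin k → Poly) → prodP f ≡ Ops.prodF polyRing f
  prodP≡prodF {zero}  f = ≡.sym 𝟙≡1
  prodP≡prodF {suc k} f =
    ≡.trans (≡.sym (⊗≡*P (f Fin.zero) _)) (≡.cong (f Fin.zero ⊗_) (prodP≡prodF (f ∘ Fin.suc)))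

  prodP-split : ∀ {n r} (r≤n : r ≤ n) (f : Fin n → Poly) →
    prodP f ≋ prodP (λ i → f (inject≤ i r≤n)) ⊗ prodP (λ t → f (upper r r≤n t))
  prodP-split {r = r} r≤n f
    rewrite prodP≡prodF f | prodP≡prodF (λ i → f (inject≤ i r≤n))
          | prodP≡prodF (λ t → f (upper r r≤n t)) =
    Sums.prodF-split polyRing r≤n f

-- Degree bounds, monic polynomials and division with remainder.

module Degrees {c ℓ} (R : CommutativeRing c ℓ) where
  open CommutativeRing R hiding (zero)
  open Ops R
  open Polynomials R
  private module P = CommutativeRing polyRing
  open import Algebra.Properties.Ring ring using (-0#≈0#)
  import Algebra.Properties.Ring P.ring as PP
  open import Algebra.Solver.Ring.NaturalCoefficients.Default P.commutativeSemiring
    using (solve; _:+_; _:*_; _:=_)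

  private
    0*-+ : ∀ {x y u v} → x ≈ 0# → u ≈ v → x * y + u ≈ v
    0*-+ e f = trans (+-cong (trans (*-congʳ e) (zeroˡ _)) f) (+-identityˡ _)

    *0-+ : ∀ {x y u v} → y ≈ 0# → u ≈ v → x * y + u ≈ v
    *0-+ e f = trans (+-cong (trans (*-congˡ e) (zeroʳ _)) f) (+-identityˡ _)

  coeff-𝟘 : ∀ k → coeff 𝟘 k ≈ 0#
  coeff-𝟘 k rewrite 𝟘≡[] = refl

  coeff-⊗-zero : ∀ p q → coeff (p ⊗ q) 0 ≈ coeff p 0 * coeff q 0
  coeff-⊗-zero p q rewrite ⊗≡*P p q = coeff-*P-zero p q

  coeff-∷⊗-suc : ∀ a p q k → coeff ((a ∷ p) ⊗ q) (suc k) ≈ a * coeff q (suc k) + coeff (p ⊗ q) k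
  coeff-∷⊗-suc a p q k rewrite ⊗≡*P (a ∷ p) q | ⊗≡*P p q = coeff-*P-suc (a ∷ p) q k

  coeff-constP⊗ : ∀ a p k → coeff (constP a ⊗ p) k ≈ a * coeff p k
  coeff-constP⊗ a p zero    = coeff-⊗-zero (constP a) p
  coeff-constP⊗ a p (suc k) rewrite ⊗≡*P (constP a) p =
    trans (coeff-*P-suc (constP a) p k) (+-identityʳ _)

  coeff-X⊗-zero : ∀ p → coeff (X ⊗ p) 0 ≈ 0#
  coeff-X⊗-zero p = trans (coeff-⊗-zero X p) (zeroˡ _)

  coeff-X⊗-suc : ∀ p k → coeff (X ⊗ p) (suc k) ≈ coeff p k
  coeff-X⊗-suc p k =
    trans (coeff-∷⊗-suc 0# (constP 1#) p k)
      (0*-+ refl (trans (coeff-constP⊗ 1# p k) (*-identityˡ _)))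

  ∷≋ : ∀ a p → (a ∷ p) ≋ constP a ⊕ X ⊗ p
  at (∷≋ a p) zero = sym (trans (coeff-⊕ (constP a) (X ⊗ p) 0)
    (trans (+-congˡ (coeff-X⊗-zero p)) (+-identityʳ a)))
  at (∷≋ a p) (suc k) = sym (trans (coeff-⊕ (constP a) (X ⊗ p) (suc k))
    (trans (+-identityˡ _) (coeff-X⊗-suc p k)))

  constP-cong : ∀ {a b} → a ≈ b → constP a ≋ constP b
  at (constP-cong e) zero    = e
  at (constP-cong e) (suc k) = refl

  constP-0 : constP 0# ≋ 𝟘
  at constP-0 zero    = sym (coeff-𝟘 0)
  at constP-0 (suc k) = sym (coeff-𝟘 (suc k))

  constP-⊕ : ∀ a b → constP (a + b) ≋ constP a ⊕ constP b
  at (constP-⊕ a b) zero    = sym (coeff-⊕ (constP a) (constP b) 0)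
  at (constP-⊕ a b) (suc k) = sym (trans (coeff-⊕ (constP a) (constP b) (suc k)) (+-identityˡ _))

  constP-⊗ : ∀ a b → constP (a * b) ≋ constP a ⊗ constP b
  at (constP-⊗ a b) zero    = sym (coeff-⊗-zero (constP a) (constP b))
  at (constP-⊗ a b) (suc k) = sym (trans (coeff-constP⊗ a (constP b) (suc k)) (zeroʳ a))

  constP-⊖ : ∀ a → constP (- a) ≋ ⊖ constP a
  at (constP-⊖ a) zero    = sym (coeff-⊖ (constP a) 0)
  at (constP-⊖ a) (suc k) = sym (trans (coeff-⊖ (constP a) (suc k)) -0#≈0#)

  -- Built with the raw `_-P_`, so that the linear factors in the theorem are instances by
  -- definition.
  linear : Carrier → Poly
  linear a = X -P constP a

  linear≋ : ∀ a → linear a ≋ X ⊕ ⊖ constP a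
  linear≋ a rewrite ⊖≡-P (constP a) | ⊕≡+P X (-P constP a) = P.refl

  -- Horner's scheme: p = p(a) + (x - a) q gives b + x p = (b + a p(a)) + (x - a)(p(a) + x q).
  synthetic-division : ∀ p a → ∃[ q ] p ≋ constP (eval p a) ⊕ linear a ⊗ q
  synthetic-division [] a = 𝟘 , P.sym (P.trans (P.+-cong constP-0 (P.zeroʳ _))
    (P.trans (P.+-identityˡ _) (coeffwise (λ k → coeff-𝟘 k))))
  synthetic-division (b ∷ p) a with synthetic-division p a
  ... | q , e = constP (eval p a) ⊕ X ⊗ q , (begin
    b ∷ p                                     ≈⟨ ∷≋ b p ⟩
    constP b ⊕ X ⊗ p                          ≈⟨ P.+-congˡ (P.*-congˡ e) ⟩
    constP b ⊕ X ⊗ (v ⊕ linear a ⊗ q)         ≈⟨ solve 5 (λ b x v l q →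
      b :+ x :* (v :+ l :* q) := b :+ (x :* v :+ l :* (x :* q))) P.refl (constP b) X v (linear a) q ⟩
    constP b ⊕ (X ⊗ v ⊕ linear a ⊗ (X ⊗ q))
      ≈⟨ P.+-congˡ (P.+-congʳ (P.*-congʳ X≋)) ⟩
    constP b ⊕ ((constP a ⊕ linear a) ⊗ v ⊕ linear a ⊗ (X ⊗ q))
      ≈⟨ solve 5 (λ b c v l r →
      b :+ ((c :+ l) :* v :+ l :* r) := (b :+ c :* v) :+ l :* (v :+ r))
      P.refl (constP b) (constP a) v (linear a) (X ⊗ q) ⟩
    (constP b ⊕ constP a ⊗ v) ⊕ linear a ⊗ (v ⊕ X ⊗ q)
      ≈⟨ P.+-congʳ (P.trans (constP-⊕ _ _) (P.+-congˡ (constP-⊗ _ _))) ⟨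
    constP (eval (b ∷ p) a) ⊕ linear a ⊗ (v ⊕ X ⊗ q) ∎)
    where
    open import Relation.Binary.Reasoning.Setoid P.setoid
    v = constP (eval p a)
    X≋ : X ≋ constP a ⊕ linear a
    X≋ = P.sym (P.trans (P.+-congˡ (linear≋ a)) (P.trans (P.+-comm _ _)
      (P.trans (P.+-assoc _ _ _) (P.trans (P.+-congˡ (P.-‿inverseˡ _)) (P.+-identityʳ _)))))

  -- The bound deg p < m. A bound, unlike the degree itself, makes sense for lists with trailing
  -- zeros and without deciding which coefficients vanish.
  Vanishing : ℕ → Poly → Set ℓ
  Vanishing m p = ∀ k → m ≤ k → coeff p k ≈ 0#

  Monic : ℕ → Poly → Set ℓ
  Monic m p = coeff p m ≈ 1# × Vanishing (suc m) p

  vanishing-0 : ∀ {p} → Vanishing 0 p → p ≋ 𝟘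
  at (vanishing-0 v) k = trans (v k z≤n) (sym (coeff-𝟘 k))

  vanishing-cong : ∀ {m p q} → p ≋ q → Vanishing m p → Vanishing m q
  vanishing-cong e v k m≤k = trans (sym (at e k)) (v k m≤k)

  monic-cong : ∀ {m p q} → p ≋ q → Monic m p → Monic m q
  monic-cong e (l , v) = trans (sym (at e _)) l , vanishing-cong e v

  vanishing-𝟘⊗ : ∀ m {p} q → Vanishing 0 p → Vanishing m (p ⊗ q)
  vanishing-𝟘⊗ m q v k _ =
    trans (at (P.trans (P.*-congʳ (vanishing-0 v)) (P.zeroˡ q)) k) (coeff-𝟘 k)

  -- The bounds are asymmetric, deg p < a and deg q ≤ b, so that deg (p q) < a + b comes out without
  -- subtracting one.
  vanishing-⊗ : ∀ {a b} p q → Vanishing a p → Vanishing (suc b) q → Vanishing (a ℕ.+ b) (p ⊗ q)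
  vanishing-⊗ {zero}  p       q u v = vanishing-𝟘⊗ _ q u
  vanishing-⊗ {suc a} []      q u v = vanishing-𝟘⊗ _ q (λ _ _ → refl)
  vanishing-⊗ {suc a} {b} (x ∷ p) q u v (suc k) (s≤s le) =
    trans (coeff-∷⊗-suc x p q k)
      (*0-+ (v (suc k) (s≤s (ℕₚ.≤-trans (ℕₚ.m≤n+m b a) le)))
        (vanishing-⊗ p q (λ j a≤j → u (suc j) (s≤s a≤j)) v k le))

  monic-⊗ : ∀ {a b} p q → Monic a p → Monic b q → Monic (a ℕ.+ b) (p ⊗ q)
  monic-⊗ {a} {b} p q (l , u) (m , v) = lead a p l u , vanishing-⊗ p q u v
    where
    lead : ∀ a p → coeff p a ≈ 1# → Vanishing (suc a) p → coeff (p ⊗ q) (a ℕ.+ b) ≈ 1#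
    lead zero p l u = trans (at (P.*-congʳ p≋𝟙) b) (trans (at (P.*-identityˡ q) b) m)
      where
      p≋𝟙 : p ≋ 𝟙
      at p≋𝟙 zero    rewrite 𝟙≡1 = l
      at p≋𝟙 (suc k) rewrite 𝟙≡1 = u (suc k) (s≤s z≤n)
    lead (suc a) []      l u = trans (vanishing-𝟘⊗ 0 q (λ _ _ → refl) _ z≤n) l
    lead (suc a) (x ∷ p) l u = trans (coeff-∷⊗-suc x p q (a ℕ.+ b))
      (*0-+ (v _ (s≤s (ℕₚ.m≤n+m b a))) (lead a p l (λ k le → u (suc k) (s≤s le))))

  monic-𝟙 : Monic 0 (constP 1#)
  monic-𝟙 = refl , λ { (suc k) _ → refl }

  monic-linear : ∀ a → Monic 1 (linear a)
  monic-linear a = refl , λ { (suc (suc k)) _ → refl ; (suc zero) (s≤s ()) }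

  monic-prodP : ∀ m (ω : Fin m → Carrier) → Monic m (prodP (λ i → linear (ω i)))
  monic-prodP zero    ω = monic-𝟙
  monic-prodP (suc m) ω
    rewrite ≡.sym (⊗≡*P (linear (ω Fin.zero)) (prodP (λ i → linear (ω (Fin.suc i))))) =
    monic-⊗ (linear (ω Fin.zero)) _ (monic-linear _) (monic-prodP m (λ i → ω (Fin.suc i)))

  -- A monic factor lets no top coefficient cancel, even with zero divisors around. Above index m
  -- the head `a` contributes nothing, so the tail inherits a bound; for k = 0 the tail vanishes and
  -- the coefficient of the product at m is `a` itself.
  quotient-vanishing : ∀ {m} k f g → Monic m f → Vanishing (m ℕ.+ k) (g ⊗ f) → Vanishing k g
  quotient-vanishing k f [] mf v j _ = refl
  quotient-vanishing {m} k f (a ∷ g) mf@(l , u) v = step k v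
    where
    rest : ∀ k → (∀ j → m ℕ.+ k ≤ j → coeff ((a ∷ g) ⊗ f) (suc j) ≈ 0#) → Vanishing k g
    rest k v = quotient-vanishing k f g mf (λ j le → trans
      (sym (*0-+ (u (suc j) (s≤s (ℕₚ.≤-trans (ℕₚ.m≤m+n m k) le))) refl))
      (trans (sym (coeff-∷⊗-suc a g f j)) (v j le)))
    step : ∀ k → Vanishing (m ℕ.+ k) ((a ∷ g) ⊗ f) → Vanishing k (a ∷ g)
    step (suc k) v (suc j) (s≤s le) =
      rest k (λ i le′ → v (suc i) (≡.subst (_≤ suc i) (≡.sym (ℕₚ.+-suc m k)) (s≤s le′))) j le
    step zero v = λ { zero _ → a≈0 ; (suc j) _ → g≈0 j z≤n }
      where
      g≈0 : Vanishing 0 g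
      g≈0 = rest zero (λ j le → v (suc j) (ℕₚ.m≤n⇒m≤1+n le))
      top : ∀ m → coeff f m ≈ 1# → coeff ((a ∷ g) ⊗ f) m ≈ a
      top zero    l = trans (coeff-⊗-zero (a ∷ g) f) (trans (*-congˡ l) (*-identityʳ a))
      top (suc m) l = trans (coeff-∷⊗-suc a g f m) (trans
        (+-cong (trans (*-congˡ l) (*-identityʳ a)) (vanishing-𝟘⊗ 0 f g≈0 m z≤n)) (+-identityʳ a))
      a≈0 : a ≈ 0#
      a≈0 = trans (sym (top m l)) (v m (ℕₚ.≤-reflexive (ℕₚ.+-identityʳ m)))

  monic-cancel : ∀ {m} f g h → Monic m f → g ⊗ f ≋ h ⊗ f → g ≋ h
  monic-cancel f g h mf e = PP.x∙y⁻¹≈ε⇒x≈y g h (vanishing-0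
    (quotient-vanishing 0 f (g ⊕ ⊖ h) mf (λ k _ → trans (at difference k) (coeff-𝟘 k))))
    where
    difference : (g ⊕ ⊖ h) ⊗ f ≋ 𝟘
    difference = P.trans (PP.[y-z]x≈yx-zx f g h) (PP.x≈y⇒x∙y⁻¹≈ε e)

  divide : ∀ {m} f → Monic m f → ∀ p → ∃[ q ] ∃[ ρ ] (p ≋ q ⊗ f ⊕ ρ × Vanishing m ρ)
  divide f mf [] = 𝟘 , 𝟘 ,
    P.sym (P.trans (P.+-identityʳ _) (P.trans (P.zeroˡ f) (coeffwise coeff-𝟘))) , λ k _ → coeff-𝟘 k
  divide {m} f mf@(l , u) (a ∷ p) with divide f mf p
  ... | q , ρ , e , v = X ⊗ q ⊕ constP t , σ ⊕ ⊖ (constP t ⊗ f) , identity , small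
    where
    -- Prepending a coefficient turns the old remainder ρ into a + xρ, of degree at most m.
    -- Subtracting its coefficient `t` at m times the monic `f` brings the degree below m again.
    σ = constP a ⊕ X ⊗ ρ
    t = coeff σ m
    open import Relation.Binary.Reasoning.Setoid P.setoid
    identity : (a ∷ p) ≋ (X ⊗ q ⊕ constP t) ⊗ f ⊕ (σ ⊕ ⊖ (constP t ⊗ f))
    identity = begin
      a ∷ p                                ≈⟨ ∷≋ a p ⟩
      constP a ⊕ X ⊗ p                     ≈⟨ P.+-congˡ (P.*-congˡ e) ⟩
      constP a ⊕ X ⊗ (q ⊗ f ⊕ ρ)           ≈⟨ solve 5 (λ a x q f r →
        a :+ x :* (q :* f :+ r) := x :* q :* f :+ (a :+ x :* r)) P.refl (constP a) X q f ρ ⟩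
      X ⊗ q ⊗ f ⊕ σ                        ≈⟨ P.+-congʳ (P.+-identityʳ _) ⟨
      X ⊗ q ⊗ f ⊕ 𝟘 ⊕ σ
        ≈⟨ P.+-congʳ (P.+-congˡ (P.-‿inverseʳ (constP t ⊗ f))) ⟨
      X ⊗ q ⊗ f ⊕ (constP t ⊗ f ⊕ ⊖ (constP t ⊗ f)) ⊕ σ ≈⟨ solve 5 (λ xq c f n s →
        xq :* f :+ (c :* f :+ n) :+ s := (xq :+ c) :* f :+ (s :+ n)) P.refl
        (X ⊗ q) (constP t) f (⊖ (constP t ⊗ f)) σ ⟩
      (X ⊗ q ⊕ constP t) ⊗ f ⊕ (σ ⊕ ⊖ (constP t ⊗ f)) ∎
    σ-small : Vanishing (suc m) σ
    σ-small (suc k) (s≤s le) = trans (coeff-⊕ (constP a) (X ⊗ ρ) (suc k))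
      (trans (+-identityˡ _) (trans (coeff-X⊗-suc ρ k) (v k le)))
    coeff-remainder : ∀ k → coeff (σ ⊕ ⊖ (constP t ⊗ f)) k ≈ coeff σ k - t * coeff f k
    coeff-remainder k = trans (coeff-⊕ σ _ k) (+-congˡ (trans (coeff-⊖ (constP t ⊗ f) k)
      (-‿cong (coeff-constP⊗ t f k))))
    small : Vanishing m (σ ⊕ ⊖ (constP t ⊗ f))
    small k m≤k with m ℕ.≟ k
    ... | yes ≡.refl = trans (coeff-remainder m)
      (trans (+-congˡ (-‿cong (trans (*-congˡ l) (*-identityʳ t)))) (-‿inverseʳ t))
    ... | no m≢k = trans (coeff-remainder k) (trans
      (+-cong (σ-small k (ℕₚ.≤∧≢⇒< m≤k m≢k))
        (-‿cong (trans (*-congˡ (u k (ℕₚ.≤∧≢⇒< m≤k m≢k))) (zeroʳ t))))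
      (-‿inverseʳ 0#))

-- Linear functionals on polynomials and on residues modulo x^n - 1.

module Pairings {c ℓ} (R : CommutativeRing c ℓ) where
  open CommutativeRing R hiding (zero)
  open Ops R
  open Polynomials R
  open Degrees R
  private module P = CommutativeRing polyRing
  open import Algebra.Properties.Ring ring using (-1*x≈-x; x≈y⇒x∙y⁻¹≈ε)
  open import Algebra.Properties.CommutativeSemigroup +-commutativeSemigroup
    using () renaming (interchange to +-interchange)

  -- A linear functional is given by its values: `w k` is the image of x^k.
  pair : Poly → (ℕ → Carrier) → Carrier
  pair []      w = 0#
  pair (a ∷ p) w = a * w 0 + pair p (w ∘ suc)

  pair-zero : ∀ p w → (∀ k → coeff p k * w k ≈ 0#) → pair p w ≈ 0#
  pair-zero []      w e = refl
  pair-zero (a ∷ p) w e = trans (+-cong (e 0) (pair-zero p _ (e ∘ suc))) (+-identityˡ 0#)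

  pair-cong : ∀ p q {w w′} → p ≋ q → (∀ k → w k ≈ w′ k) → pair p w ≈ pair q w′
  pair-cong []      q {w′ = w′} e f =
    sym (pair-zero q w′ (λ k → trans (*-congʳ (sym (at e k))) (zeroˡ _)))
  pair-cong (a ∷ p) [] {w} e f = pair-zero (a ∷ p) w (λ k → trans (*-congʳ (at e k)) (zeroˡ _))
  pair-cong (a ∷ p) (b ∷ q) e f =
    +-cong (*-cong (at e 0) (f 0)) (pair-cong p q (coeffwise (λ k → at e (suc k))) (f ∘ suc))

  pair-⊕ : ∀ p q w → pair (p ⊕ q) w ≈ pair p w + pair q w
  pair-⊕ p q w rewrite ⊕≡+P p q = go p q w
    where
    go : ∀ p q w → pair (p +P q) w ≈ pair p w + pair q w
    go []      q       w = sym (+-identityˡ _)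
    go (a ∷ p) []      w = sym (+-identityʳ _)
    go (a ∷ p) (b ∷ q) w =
      trans (+-cong (distribʳ _ a b) (go p q _)) (+-interchange _ _ _ _)

  pair-constP⊗ : ∀ a p w → pair (constP a ⊗ p) w ≈ a * pair p w
  pair-constP⊗ a p w = trans (pair-cong (constP a ⊗ p) (List.map (a *_) p)
    (coeffwise (λ k → trans (coeff-constP⊗ a p k) (sym (coeff-scale a p k)))) (λ _ → refl)) (go p w)
    where
    go : ∀ p w → pair (List.map (a *_) p) w ≈ a * pair p w
    go []      w = sym (zeroʳ a)
    go (b ∷ p) w = trans (+-cong (*-assoc _ _ _) (go p _)) (sym (distribˡ _ _ _))

  pair-X⊗ : ∀ p w → pair (X ⊗ p) w ≈ pair p (w ∘ suc)
  pair-X⊗ p w = trans (pair-cong (X ⊗ p) (0# ∷ p)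
    (coeffwise λ { zero → coeff-X⊗-zero p ; (suc k) → coeff-X⊗-suc p k }) (λ _ → refl))
    (trans (+-congʳ (zeroˡ _)) (+-identityˡ _))

  -- Bilinear expansion, with x^i x^j sent to `w (i + j)`.
  pair-⊗ : ∀ p q w → pair (p ⊗ q) w ≈ pair p (λ i → pair q (λ j → w (i ℕ.+ j)))
  pair-⊗ [] q w = trans (pair-cong ([] ⊗ q) [] []⊗ (λ _ → refl)) refl
    where
    []⊗ : [] ⊗ q ≋ []
    []⊗ rewrite ⊗≡*P [] q = P.refl
  pair-⊗ (a ∷ p) q w =
    trans (pair-cong ((a ∷ p) ⊗ q) (constP a ⊗ q ⊕ X ⊗ (p ⊗ q)) split (λ _ → refl))
    (trans (pair-⊕ (constP a ⊗ q) _ w)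
      (+-cong (pair-constP⊗ a q w) (trans (pair-X⊗ (p ⊗ q) w) (pair-⊗ p q (w ∘ suc)))))
    where
    split : (a ∷ p) ⊗ q ≋ constP a ⊗ q ⊕ X ⊗ (p ⊗ q)
    split = P.trans (P.*-congʳ (∷≋ a p)) (P.trans (P.distribʳ _ _ _) (P.+-congˡ (P.*-assoc _ _ _)))

  -- Such a functional kills every x^k (x^n - 1), so it descends to residues: entries of a reduced
  -- row can be read off the unreduced polynomial.
  Periodic : ℕ → (ℕ → Carrier) → Set ℓ
  Periodic n w = ∀ k → w (k ℕ.+ n) ≈ w k

  private
    x^_ : ℕ → Poly
    x^ m = List.replicate m 0# List.++ (1# ∷ [])

    pair-x^ : ∀ m w → pair (x^ m) w ≈ w m
    pair-x^ zero    w = trans (+-identityʳ _) (*-identityˡ _)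
    pair-x^ (suc m) w = trans (+-congʳ (zeroˡ _)) (trans (+-identityˡ _) (pair-x^ m _))

    monic-x^ : ∀ m → Monic m (x^ m)
    monic-x^ zero    = monic-𝟙
    monic-x^ (suc m) with monic-x^ m
    ... | l , v = l , λ { (suc k) (s≤s le) → v k le }

  pair-xⁿ-1 : ∀ n w → w n ≈ w 0 → pair (xⁿ-1 n) w ≈ 0#
  pair-xⁿ-1 zero    w e = trans (+-identityʳ _) (zeroˡ _)
  pair-xⁿ-1 (suc n) w e = trans (+-cong (-1*x≈-x _) (pair-x^ n _))
    (trans (+-comm _ _) (x≈y⇒x∙y⁻¹≈ε e))

  pair-periodic : ∀ n p w → Periodic n w → pair (p ⊗ xⁿ-1 n) w ≈ 0#
  pair-periodic n p w per = trans (pair-⊗ p (xⁿ-1 n) w) (pair-zero p _ (λ k → trans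
    (*-congˡ (pair-xⁿ-1 n (λ j → w (k ℕ.+ j))
      (trans (per k) (reflexive (≡.cong w (≡.sym (ℕₚ.+-identityʳ k)))))))
    (zeroʳ _)))

  monic-xⁿ-1 : ∀ {n} → 0 < n → Monic n (xⁿ-1 n)
  monic-xⁿ-1 {suc n} _ with monic-x^ n
  ... | l , v = l , λ { (suc k) (s≤s le) → v k le }

-- Alternating forms modulo z and the determinant of multiplication by G.

module AlternatingForms {c ℓ} (R : CommutativeRing c ℓ) (z : Ops.Poly R) where
  open CommutativeRing R hiding (zero)
  open Ops R
  open Sums R
  open Polynomials R
  open Degrees R
  private module P = CommutativeRing polyRing
  open import Relation.Binary.Reasoning.Setoid setoid
  open import Algebra.Properties.CommutativeSemigroup *-commutativeSemigroup
    using (x∙yz≈y∙xz)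
  open import Algebra.Properties.CommutativeSemigroup P.*-commutativeSemigroup
    using () renaming (x∙yz≈y∙xz to ⊗-x∙yz≈y∙xz; xy∙z≈y∙xz to ⊗-xy∙z≈y∙xz)

  infixr 5 _◂_
  _◂_ : ∀ {k} → Poly → (Fin k → Poly) → Fin (suc k) → Poly
  _◂_ = Vector._∷_

  Form : ℕ → Set c
  Form k = (Fin k → Poly) → Carrier

  Congruent : ∀ {k} → Form k → Set (c ⊔ ℓ)
  Congruent φ = ∀ {u v} → (∀ i → u i ≋ v i) → φ u ≈ φ v

  Repetition : ∀ {k} → Form k → Set (c ⊔ ℓ)
  Repetition {suc (suc k)} φ = ∀ u rest → φ (u ◂ u ◂ rest) ≈ 0#
  Repetition               φ = ⊤

  -- The law `modulus` takes the place of a quotient ring, so rows stay plain polynomials and are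
  -- never reduced.
  record LinearInHead {k} (φ : Form (suc k)) : Set (c ⊔ ℓ) where
    field
      congruent : Congruent φ
      linearity : ∀ a u v rest →
        φ (constP a ⊗ u ⊕ v ◂ rest) ≈ a * φ (u ◂ rest) + φ (v ◂ rest)
      modulus   : ∀ p rest → φ (p ⊗ z ◂ rest) ≈ 0#

  -- Alternating multilinear forms on k polynomials modulo z, by recursion on the
  -- first argument: only repetitions in adjacent places are required to vanish.
  Alternating : ∀ k → Form k → Set (c ⊔ ℓ)
  Alternating zero    φ = Congruent φ
  Alternating (suc k) φ =
    LinearInHead φ × Repetition φ × (∀ u → Alternating k (λ rest → φ (u ◂ rest)))

  -- A determinant with its first row fixed is a linear combination of smaller determinants. This
  -- closure under multiples, and the one under sums below, let `Alternating` pass to the tail.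
  alternating-scale : ∀ k a {φ} → Alternating k φ → Alternating k (λ rows → a * φ rows)
  alternating-scale zero    a alt e = *-congˡ (alt e)
  alternating-scale (suc k) a {φ} (lin , rep , tail) =
    record
      { congruent = λ e → *-congˡ (congruent e)
      ; linearity = λ b u v rest → trans (*-congˡ (linearity b u v rest))
          (trans (distribˡ _ _ _) (+-congʳ (x∙yz≈y∙xz _ _ _)))
      ; modulus   = λ p rest → trans (*-congˡ (modulus p rest)) (zeroʳ a)
      } , repetition k rep , λ u → alternating-scale k a (tail u)
    where
    open LinearInHead lin
    repetition : ∀ k {φ : Form (suc k)} → Repetition φ → Repetition (λ rows → a * φ rows)
    repetition zero    rep = tt
    repetition (suc k) rep u rest = trans (*-congˡ (rep u rest)) (zeroʳ a)

  alternating-sum : ∀ k {m} {φ : Fin m → Form k} → (∀ j → Alternating k (φ j)) →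
    Alternating k (λ rows → sumF (λ j → φ j rows))
  alternating-sum zero    alt e = sumF-cong (λ j → alt j e)
  alternating-sum (suc k) {φ = φ} alt =
    record
      { congruent = λ e → sumF-cong (λ j → congruent (proj₁ (alt j)) e)
      ; linearity = λ b u v rest → trans (sumF-cong (λ j → linearity (proj₁ (alt j)) b u v rest))
          (trans (sumF-+ (λ j → b * φ j (u ◂ rest)) (λ j → φ j (v ◂ rest)))
            (+-congʳ (sym (*-sumF b (λ j → φ j (u ◂ rest))))))
      ; modulus   = λ p rest → sumF-zero (λ j → modulus (proj₁ (alt j)) p rest)
      } , repetition k (λ j → proj₁ (proj₂ (alt j)))
        , λ u → alternating-sum k (λ j → proj₂ (proj₂ (alt j)) u)
    where
    open LinearInHead
    repetition : ∀ k {m} {φ : Fin m → Form (suc k)} → (∀ j → Repetition (φ j)) →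
      Repetition (λ rows → sumF (λ j → φ j rows))
    repetition zero    rep = tt
    repetition (suc k) rep u rest = sumF-zero (λ j → rep j u rest)

  ◂-cong : ∀ {k} {u v : Poly} {r s : Fin k → Poly} → u ≋ v → (∀ i → r i ≋ s i) →
    ∀ i → (u ◂ r) i ≋ (v ◂ s) i
  ◂-cong e f Fin.zero    = e
  ◂-cong e f (Fin.suc i) = f i

  ◂-eta : ∀ {k} (v : Fin (suc k) → Poly) i → v i ≋ (v Fin.zero ◂ (v ∘ Fin.suc)) i
  ◂-eta v Fin.zero    = P.refl
  ◂-eta v (Fin.suc i) = P.refl

  additivity : ∀ {k} {φ : Form (suc k)} → LinearInHead φ → ∀ u v rest →
    φ (u ⊕ v ◂ rest) ≈ φ (u ◂ rest) + φ (v ◂ rest)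
  additivity lin u v rest = trans
    (congruent (◂-cong (P.+-congʳ (P.sym (P.trans (P.*-congʳ 1≋𝟙) (P.*-identityˡ u)))) (λ _ → P.refl)))
    (trans (linearity 1# u v rest) (+-congʳ (*-identityˡ _)))
    where
    open LinearInHead lin
    1≋𝟙 : constP 1# ≋ 𝟙
    1≋𝟙 rewrite 𝟙≡1 = P.refl

  -- In φ(u + v, u + v, ...) = 0 the two terms with equal entries drop out, leaving φ(u, v, ...) +
  -- φ(v, u, ...) = 0.
  vanishing-swap : ∀ {k} {φ : Form (suc (suc k))} → Alternating (suc (suc k)) φ → ∀ u v rest →
    φ (u ◂ v ◂ rest) ≈ 0# → φ (v ◂ u ◂ rest) ≈ 0#
  vanishing-swap {φ = φ} (lin , rep , tail) u v rest e = begin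
    φ (v ◂ u ◂ rest)                          ≈⟨ +-identityʳ _ ⟨
    φ (v ◂ u ◂ rest) + 0#                     ≈⟨ +-congˡ (rep v rest) ⟨
    φ (v ◂ u ◂ rest) + φ (v ◂ v ◂ rest)       ≈⟨ additivity (proj₁ (tail v)) u v rest ⟨
    φ (v ◂ u ⊕ v ◂ rest)                      ≈⟨ +-identityˡ _ ⟨
    0# + φ (v ◂ u ⊕ v ◂ rest)                 ≈⟨ +-congʳ (trans (additivity (proj₁ (tail u)) u v rest)
                                                   (trans (+-cong (rep u rest) e) (+-identityˡ 0#))) ⟨
    φ (u ◂ u ⊕ v ◂ rest) + φ (v ◂ u ⊕ v ◂ rest) ≈⟨ additivity lin u v _ ⟨
    φ (u ⊕ v ◂ u ⊕ v ◂ rest)                  ≈⟨ rep (u ⊕ v) rest ⟩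
    0#                                        ∎

  -- Each row receives `a` times the row before it. The rows are treated from the last one upwards,
  -- so the row being added is still the original one.
  shift : ∀ k {φ} → Alternating (suc k) φ → ∀ a (v : ℕ → Poly) →
    φ (λ i → v (toℕ i)) ≈ φ (v 0 ◂ (λ i → constP a ⊗ v (toℕ i) ⊕ v (suc (toℕ i))))
  shift zero    {φ} (lin , _ , _) a v =
    LinearInHead.congruent lin λ { Fin.zero → P.refl }
  shift (suc k) {φ} alt@(lin , rep , tail) a v = begin
    φ (λ i → v (toℕ i))                      ≈⟨ congruent (◂-eta _) ⟩
    φ (v 0 ◂ (λ i → v (suc (toℕ i))))        ≈⟨ shift k (tail (v 0)) a (v ∘ suc) ⟩
    φ (v 0 ◂ v 1 ◂ w)                        ≈⟨ +-identityˡ _ ⟨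
    0# + φ (v 0 ◂ v 1 ◂ w)                   ≈⟨ +-congʳ (trans (*-congˡ (rep (v 0) w)) (zeroʳ a)) ⟨
    a * φ (v 0 ◂ v 0 ◂ w) + φ (v 0 ◂ v 1 ◂ w)
      ≈⟨ LinearInHead.linearity (proj₁ (tail (v 0))) a (v 0) (v 1) w ⟨
    φ (v 0 ◂ constP a ⊗ v 0 ⊕ v 1 ◂ w)
      ≈⟨ congruent (◂-cong P.refl (λ i → P.sym (◂-eta (λ i → constP a ⊗ v (toℕ i) ⊕ v (suc (toℕ i))) i))) ⟩
    φ (v 0 ◂ (λ i → constP a ⊗ v (toℕ i) ⊕ v (suc (toℕ i)))) ∎
    where
    open LinearInHead lin
    w = λ i → constP a ⊗ v (suc (toℕ i)) ⊕ v (suc (suc (toℕ i)))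

  X^_ : ℕ → Poly
  X^ i = Ops.pow polyRing X i

  multiples : ∀ {m} → Poly → Fin m → Poly
  multiples Q i = X^ toℕ i ⊗ Q

  multiples-cong : ∀ {m Q Q′} → Q ≋ Q′ → ∀ (i : Fin m) → multiples Q i ≋ multiples Q′ i
  multiples-cong e i = P.*-congˡ e

  factor-out : ∀ k {φ} → Alternating (suc k) φ → ∀ a Q →
    φ (multiples Q) ≈ φ (Q ◂ multiples (linear a ⊗ Q))
  -- With row i equal to x^i Q the shifted row is x^(i+1) Q - a x^i Q = x^i (x - a) Q.
  factor-out k alt a Q = trans (shift k alt (- a) (λ i → X^ i ⊗ Q))
    (LinearInHead.congruent (proj₁ alt) (◂-cong (P.*-identityˡ Q) (λ i → step (X^ toℕ i))))
    where
    step : ∀ y → constP (- a) ⊗ (y ⊗ Q) ⊕ (X ⊗ y) ⊗ Q ≋ y ⊗ (linear a ⊗ Q)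
    step y = P.sym (P.trans (P.*-congˡ (P.*-congʳ (P.trans (linear≋ a)
        (P.trans (P.+-comm _ _) (P.+-congʳ (P.sym (constP-⊖ a)))))))
      (P.trans (⊗-x∙yz≈y∙xz _ _ _) (P.trans (P.distribʳ _ _ _)
        (P.+-congˡ (P.sym (P.*-assoc X y Q))))))

  private
    prodP-step : ∀ {m} (ω : Fin (suc m) → Carrier) H E →
      prodP (λ i → linear (ω i)) ⊗ H ≋ E ⊗ z →
      prodP (λ i → linear (ω (Fin.suc i))) ⊗ (linear (ω Fin.zero) ⊗ H) ≋ E ⊗ z
    prodP-step ω H E e = P.trans
      (P.sym (P.trans (P.*-congʳ (P.reflexive (≡.sym (⊗≡*P (linear (ω Fin.zero)) _)))) (⊗-xy∙z≈y∙xz _ _ _))) e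

    divide-root : ∀ p a H q → p ≋ constP (eval p a) ⊕ linear a ⊗ q →
      p ⊗ H ≋ constP (eval p a) ⊗ H ⊕ q ⊗ (linear a ⊗ H)
    divide-root p a H q e = P.trans (P.*-congʳ e)
      (P.trans (P.distribʳ _ _ _) (P.+-congˡ (⊗-xy∙z≈y∙xz _ _ _)))

  -- A monic polynomial of degree m sends H into the multiples of z, so H, ..., x^(m-1) H span all
  -- multiples of H modulo z. Instead of dividing p by that polynomial, one root a is split off: p =
  -- p(a) + (x - a) q, where p(a) H repeats the row H, and q (x - a) H is the same claim for (x - a)
  -- H with one root fewer. When no root is left, H itself is a multiple of z.
  spanned-vanishes : ∀ m {φ} → Alternating (suc m) φ → ∀ (ω : Fin m → Carrier) H E →
    prodP (λ i → linear (ω i)) ⊗ H ≋ E ⊗ z → ∀ p → φ (p ⊗ H ◂ multiples H) ≈ 0#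
  spanned-vanishes zero (lin , _) ω H E e p = trans
    (congruent (◂-cong {r = multiples H} {s = multiples H}
      (P.trans (P.*-congˡ H≋) (P.sym (P.*-assoc p E z))) (λ ())))
    (modulus (p ⊗ E) (multiples H))
    where
    open LinearInHead lin
    H≋ : H ≋ E ⊗ z
    H≋ = P.trans (P.sym (P.trans (P.*-congʳ (P.reflexive (≡.sym 𝟙≡1))) (P.*-identityˡ H))) e
  spanned-vanishes (suc m) {φ} alt@(lin , rep , tail) ω H E e p
    with synthetic-division p (ω Fin.zero)
  ... | q , p≋ = begin
    φ (p ⊗ H ◂ multiples H)                         ≈⟨ factor-out m (tail (p ⊗ H)) a H ⟩
    φ (p ⊗ H ◂ H ◂ multiples H′)
      ≈⟨ congruent (◂-cong (divide-root p a H q p≋) (λ _ → P.refl)) ⟩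
    φ (constP (eval p a) ⊗ H ⊕ q ⊗ H′ ◂ H ◂ multiples H′) ≈⟨ linearity (eval p a) H (q ⊗ H′) _ ⟩
    eval p a * φ (H ◂ H ◂ multiples H′) + φ (q ⊗ H′ ◂ H ◂ multiples H′)
      ≈⟨ +-cong (trans (*-congˡ (rep H (multiples H′))) (zeroʳ _))
           -- Swapping brings H to the front, where it is held fixed; the other places then have the
           -- shape of the induction hypothesis for `H′`.
           (vanishing-swap alt H (q ⊗ H′) _
             (spanned-vanishes m (tail H) (ω ∘ Fin.suc) H′ E (prodP-step ω H E e) q)) ⟩
    0# + 0#                                         ≈⟨ +-identityˡ 0# ⟩
    0#                                              ∎
    where
    open LinearInHead lin
    a = ω Fin.zero
    H′ = linear a ⊗ H

  -- Modulo ∏ (x - ω_i), multiplication by G is triangular in the basis 1, x - ω_0, (x - ω_0)(x -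
  -- ω_1), ... with diagonal G(ω_i), whether or not roots coincide. The cofactor `H` takes over one
  -- linear factor in each step.
  multiplication-determinant : ∀ m {φ} → Alternating m φ → ∀ (ω : Fin m → Carrier) G H E →
    prodP (λ i → linear (ω i)) ⊗ H ≋ E ⊗ z →
    φ (multiples (G ⊗ H)) ≈ prodF (λ i → eval G (ω i)) * φ (multiples H)
  multiplication-determinant zero alt ω G H E e = trans (alt (λ ())) (sym (*-identityˡ _))
  multiplication-determinant (suc m) {φ} alt@(lin , rep , tail) ω G H E e
    with synthetic-division G (ω Fin.zero)
  ... | q , G≋ = begin
    φ (multiples (G ⊗ H))                       ≈⟨ factor-out m alt a (G ⊗ H) ⟩
    φ (G ⊗ H ◂ multiples (linear a ⊗ (G ⊗ H)))
      ≈⟨ congruent (◂-cong P.refl (multiples-cong (⊗-x∙yz≈y∙xz (linear a) G H))) ⟩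
    -- The first row G H is held fixed while the induction strips G from the others. Only against
    -- the stripped rows can it be replaced by G(a) H.
    φ (G ⊗ H ◂ multiples (G ⊗ H′))
      ≈⟨ multiplication-determinant m (tail (G ⊗ H)) (ω ∘ Fin.suc) G H′ E e′ ⟩
    g * φ (G ⊗ H ◂ multiples H′)
      ≈⟨ *-congˡ (congruent (◂-cong (divide-root G a H q G≋) (λ _ → P.refl))) ⟩
    g * φ (constP (eval G a) ⊗ H ⊕ q ⊗ H′ ◂ multiples H′)
      ≈⟨ *-congˡ (trans (linearity (eval G a) H (q ⊗ H′) _)
           (trans (+-congˡ (spanned-vanishes m alt (ω ∘ Fin.suc) H′ E e′ q)) (+-identityʳ _))) ⟩
    g * (eval G a * φ (H ◂ multiples H′))
      ≈⟨ trans (x∙yz≈y∙xz _ _ _) (sym (*-assoc _ _ _)) ⟩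
    eval G a * g * φ (H ◂ multiples H′)         ≈⟨ *-congˡ (factor-out m alt a H) ⟨
    eval G a * g * φ (multiples H)              ∎
    where
    open LinearInHead lin
    a = ω Fin.zero
    H′ = linear a ⊗ H
    g = prodF (λ i → eval G (ω (Fin.suc i)))
    e′ = prodP-step ω H E e

-- The Laplace determinant as an alternating form.

module Determinants {c ℓ} (R : CommutativeRing c ℓ) where
  open CommutativeRing R hiding (zero)
  open Ops R
  open Sums R
  open import Relation.Binary.Reasoning.Setoid setoid
  open import Algebra.Properties.Ring ring using (-‿distribˡ-*; -‿distribʳ-*; -‿involutive)
  open import Algebra.Properties.CommutativeSemigroup *-commutativeSemigroup
    using () renaming (x∙yz≈y∙xz to *-x∙yz≈y∙xz)

  laplace : ∀ {k} → Matrix (suc k) (suc k) → Fin (suc k) → Carrier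
  laplace M j = sign (toℕ j) * (M Fin.zero j * det (λ i l → M (Fin.suc i) (punchIn j l)))

  det-cong : ∀ {k} {M N : Matrix k k} → (∀ i j → M i j ≈ N i j) → det M ≈ det N
  det-cong {zero}          e = refl
  det-cong {suc k} {M} {N} e = sumF-cong {f = laplace M} {laplace N} (λ j →
    *-congˡ {sign (toℕ j)} (*-cong (e Fin.zero j) (det-cong (λ i l → e (Fin.suc i) (punchIn j l)))))

  private
    vanishing-laplace : ∀ {k} (M : Matrix (suc k) (suc k)) j →
      det (λ i l → M (Fin.suc i) (punchIn j l)) ≈ 0# → laplace M j ≈ 0#
    vanishing-laplace M j e =
      trans (*-congˡ {sign (toℕ j)} (trans (*-congˡ e) (zeroʳ (M Fin.zero j)))) (zeroʳ (sign (toℕ j)))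

  det-zero-column : ∀ {k} (M : Matrix (suc k) (suc k)) → (∀ i → M i Fin.zero ≈ 0#) → det M ≈ 0#
  det-zero-column {k} M e = sumF-zero {f = laplace M} λ
    { Fin.zero    → trans (*-congˡ {1#} (trans (*-congʳ (e Fin.zero)) (zeroˡ _))) (zeroʳ 1#)
    ; (Fin.suc j) → vanishing-laplace M (Fin.suc j) (minor k M e j) }
    where
    minor : ∀ k (M : Matrix (suc k) (suc k)) → (∀ i → M i Fin.zero ≈ 0#) → ∀ j →
      det (λ i l → M (Fin.suc i) (punchIn (Fin.suc j) l)) ≈ 0#
    minor (suc k) M e j =
      det-zero-column (λ i l → M (Fin.suc i) (punchIn (Fin.suc j) l)) (λ i → e (Fin.suc i))

  -- The expansion runs along the first row, which may be full, but every minor except the first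
  -- keeps column 0, and that column is zero below the first row.
  det-triangular : ∀ {k} (M : Matrix k k) → (∀ i j → toℕ j < toℕ i → M i j ≈ 0#) →
    det M ≈ prodF (λ i → M i i)
  det-triangular {zero}  M e = refl
  det-triangular {suc k} M e = begin
    det M             ≈⟨ +-congˡ {laplace M Fin.zero} (sumF-zero {f = laplace M ∘ Fin.suc}
                           (λ j → vanishing-laplace M (Fin.suc j) (minor k M e j))) ⟩
    1# * (M Fin.zero Fin.zero * det M′) + 0#  ≈⟨ trans (+-identityʳ _) (*-identityˡ _) ⟩
    M Fin.zero Fin.zero * det M′
      ≈⟨ *-congˡ (det-triangular M′ (λ i j j<i → e (Fin.suc i) (Fin.suc j) (s≤s j<i))) ⟩
    prodF (λ i → M i i) ∎
    where
    M′ = λ i j → M (Fin.suc i) (Fin.suc j)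
    minor : ∀ k (M : Matrix (suc k) (suc k)) → (∀ i j → toℕ j < toℕ i → M i j ≈ 0#) → ∀ j →
      det (λ i l → M (Fin.suc i) (punchIn (Fin.suc j) l)) ≈ 0#
    minor (suc k) M e j = det-zero-column (λ i l → M (Fin.suc i) (punchIn (Fin.suc j) l))
      (λ i → e (Fin.suc i) Fin.zero (s≤s z≤n))

  -- In the double Laplace expansion the columns (0, j) and (j, 0) cancel in
  -- pairs; the terms avoiding column 0 form the same sum with one column less.
  symmetric-laplace-cancels : ∀ k
    (t : Fin (suc (suc k)) → Fin (suc (suc k)) → Carrier) → (∀ i j → t i j ≈ t j i) →
    (W : (Fin k → Fin (suc (suc k))) → Carrier) → (∀ {σ τ} → (∀ i → σ i ≡ τ i) → W σ ≈ W τ) →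
    sumF (λ j → sumF (λ l → sign (toℕ j) * (sign (toℕ l) *
      (t j (punchIn j l) * W (punchIn j ∘ punchIn l))))) ≈ 0#
  symmetric-laplace-cancels k t t-sym W W-cong = begin
    sumF (term Fin.zero) + sumF (λ j → term (Fin.suc j) Fin.zero + inner j)
      ≈⟨ +-congˡ (sumF-+ (λ j → term (Fin.suc j) Fin.zero) inner) ⟩
    sumF (term Fin.zero) + (sumF (λ j → term (Fin.suc j) Fin.zero) + sumF inner)
      ≈⟨ +-assoc _ _ _ ⟨
    (sumF (term Fin.zero) + sumF (λ j → term (Fin.suc j) Fin.zero)) + sumF inner
      ≈⟨ +-cong (sym (sumF-+ (term Fin.zero) (λ j → term (Fin.suc j) Fin.zero)))
           (inner-vanishes k t t-sym W W-cong) ⟩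
    sumF (λ j → term Fin.zero j + term (Fin.suc j) Fin.zero) + 0#
      ≈⟨ +-identityʳ _ ⟩
    sumF (λ j → term Fin.zero j + term (Fin.suc j) Fin.zero)
      ≈⟨ sumF-zero {f = λ j → term Fin.zero j + term (Fin.suc j) Fin.zero} opposite ⟩
    0# ∎
    where
    term = λ j l → sign (toℕ j) * (sign (toℕ l) * (t j (punchIn j l) * W (punchIn j ∘ punchIn l)))
    inner = λ j → sumF (λ l → term (Fin.suc j) (Fin.suc l))

    opposite : ∀ j → term Fin.zero j + term (Fin.suc j) Fin.zero ≈ 0#
    opposite j = trans
      (+-cong (trans (*-identityˡ _) (*-congˡ {sign (toℕ j)} (*-congʳ (t-sym _ _))))
        (trans (*-congˡ { - sign (toℕ j)} (*-identityˡ _)) (sym (-‿distribˡ-* (sign (toℕ j)) _))))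
      (-‿inverseʳ (sign (toℕ j) * (t (Fin.suc j) Fin.zero * W (Fin.suc ∘ punchIn j))))

    signs : ∀ a b {x y} → x ≈ y → - a * (- b * x) ≈ a * (b * y)
    signs a b {x} e = trans (trans (sym (-‿distribˡ-* a (- b * x))) (trans
      (-‿cong (trans (*-congˡ (sym (-‿distribˡ-* b x))) (sym (-‿distribʳ-* a (b * x)))))
      (-‿involutive _))) (*-congˡ (*-congˡ e))

    inner-vanishes : ∀ k
      (t : Fin (suc (suc k)) → Fin (suc (suc k)) → Carrier) → (∀ i j → t i j ≈ t j i) →
      (W : (Fin k → Fin (suc (suc k))) → Carrier) → (∀ {σ τ} → (∀ i → σ i ≡ τ i) → W σ ≈ W τ) →
      sumF (λ j → sumF (λ l → sign (toℕ (Fin.suc j)) * (sign (toℕ (Fin.suc l)) *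
        (t (Fin.suc j) (Fin.suc (punchIn j l)) *
          W (punchIn (Fin.suc j) ∘ punchIn (Fin.suc l)))))) ≈ 0#
    inner-vanishes zero    t t-sym W W-cong = sumF-zero {1} {λ _ → 0#} (λ j → refl)
    inner-vanishes (suc k) t t-sym W W-cong = trans
      (sumF-cong {f = λ j → sumF (g j)} {λ j → sumF (h j)} (λ j → sumF-cong {f = g j} {h j} (λ l →
        signs (sign (toℕ j)) (sign (toℕ l)) (*-congˡ {t (Fin.suc j) (Fin.suc (punchIn j l))}
          (W-cong {punchIn (Fin.suc j) ∘ punchIn (Fin.suc l)} {extend (punchIn j ∘ punchIn l)}
            λ { Fin.zero → ≡.refl ; (Fin.suc i) → ≡.refl })))))
      (symmetric-laplace-cancels k (λ i j → t (Fin.suc i) (Fin.suc j)) (λ i j → t-sym _ _)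
        (W ∘ extend)
        (λ e → W-cong λ { Fin.zero → ≡.refl ; (Fin.suc i) → ≡.cong Fin.suc (e i) }))
      where
      -- Deleting two columns other than 0 leaves column 0 in first place, so a column choice σ of
      -- the smaller sum is read as 0 followed by σ shifted by one.
      extend : (Fin k → Fin (suc (suc k))) → Fin (suc k) → Fin (suc (suc (suc k)))
      extend σ = Fin.zero Vector.∷ (Fin.suc ∘ σ)
      g h : Fin (suc (suc k)) → Fin (suc k) → Carrier
      g j l = - sign (toℕ j) * (- sign (toℕ l) * (t (Fin.suc j) (Fin.suc (punchIn j l)) *
        W (punchIn (Fin.suc j) ∘ punchIn (Fin.suc l))))
      h j l = sign (toℕ j) * (sign (toℕ l) * (t (Fin.suc j) (Fin.suc (punchIn j l)) *
        W (extend (punchIn j ∘ punchIn l))))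

  open Polynomials R
  open Degrees R
  open Pairings R
  private module P = CommutativeRing polyRing

  module _ {n : ℕ} where
    open AlternatingForms R (xⁿ-1 n)

    pairing-determinant : ∀ {k} → (Fin k → ℕ → Carrier) → Form k
    pairing-determinant w rows = det (λ i j → pair (rows i) (w j))

    -- Linearity and the vanishing on multiples of x^n - 1 come from the expansion along the first
    -- row, the latter because the columns are periodic functionals. If the first two rows agree,
    -- expanding both gives coefficients `x i * x j` symmetric in the two columns, and the signs
    -- cancel the terms in pairs.
    pairing-determinant-alternating : ∀ k (w : Fin k → ℕ → Carrier) → (∀ j → Periodic n (w j)) →
      Alternating k (pairing-determinant w)
    pairing-determinant-alternating zero w per e = refl
    pairing-determinant-alternating (suc k) w per =
      record
        { congruent = λ {u} {v} e → det-cong {M = λ i j → pair (u i) (w j)} {λ i j → pair (v i) (w j)}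
            (λ i j → pair-cong (u i) (v i) (e i) (λ _ → refl))
        ; linearity = linearity
        ; modulus   = modulus
        } , repetition k w
          , λ u → alternating-sum k {φ = λ j rest → s j * (pair u (w j) * D j rest)} (λ j →
              alternating-scale k (s j) (alternating-scale k (pair u (w j))
                (pairing-determinant-alternating k (w ∘ punchIn j) (per ∘ punchIn j))))
      where
      s = λ (j : Fin (suc k)) → sign (toℕ j)
      D : Fin (suc k) → Form k
      D j = pairing-determinant (w ∘ punchIn j)
      expand : Poly → (Fin k → Poly) → Fin (suc k) → Carrier
      expand u rest j = s j * (pair u (w j) * D j rest)

      linearity : ∀ a u v rest →
        pairing-determinant w (constP a ⊗ u ⊕ v ◂ rest)
          ≈ a * pairing-determinant w (u ◂ rest) + pairing-determinant w (v ◂ rest)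
      linearity a u v rest = trans
        (sumF-cong {f = expand (constP a ⊗ u ⊕ v) rest} {λ j → a * expand u rest j + expand v rest j}
          (λ j → trans (*-congˡ {s j} (trans (*-congʳ (trans (pair-⊕ (constP a ⊗ u) v (w j))
              (+-congʳ (pair-constP⊗ a u (w j)))))
            (distribʳ (D j rest) _ _)))
          (trans (distribˡ (s j) _ _)
            (+-congʳ (trans (*-congˡ (*-assoc _ _ _)) (*-x∙yz≈y∙xz (s j) a _))))))
        (trans (sumF-+ (λ j → a * expand u rest j) (expand v rest))
          (+-congʳ (sym (*-sumF a (expand u rest)))))

      modulus : ∀ p rest → pairing-determinant w (p ⊗ xⁿ-1 n ◂ rest) ≈ 0#
      modulus p rest = sumF-zero {f = expand (p ⊗ xⁿ-1 n) rest} (λ j → trans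
        (*-congˡ {s j} (trans (*-congʳ (pair-periodic n p (w j) (per j))) (zeroˡ (D j rest))))
        (zeroʳ (s j)))

      repetition : ∀ k (w : Fin (suc k) → ℕ → Carrier) → Repetition (pairing-determinant w)
      repetition zero    w = tt
      repetition (suc k) w u rest = trans
        (sumF-cong {f = λ j → ε j * (x j * sumF (inner j))} {λ j → sumF (outer j)} (λ j →
          trans (*-congˡ {ε j} (*-sumF (x j) (inner j)))
          (trans (*-sumF (ε j) (λ l → x j * inner j l))
            (sumF-cong {f = λ l → ε j * (x j * inner j l)} {outer j} (λ l →
              *-congˡ {ε j} (trans (*-x∙yz≈y∙xz (x j) (ε l) _) (*-congˡ {ε l} (sym (*-assoc _ _ _)))))))))
        (symmetric-laplace-cancels k (λ i j → x i * x j) (λ i j → *-comm _ _) W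
          (λ {σ} {τ} e → det-cong {M = λ i j → pair (rest i) (w (σ j))} {λ i j → pair (rest i) (w (τ j))}
            (λ i j → reflexive (≡.cong (λ a → pair (rest i) (w a)) (e j)))))
        where
        ε = λ {m} (j : Fin m) → sign (toℕ j)
        x = λ j → pair u (w j)
        W = λ (σ : Fin k → Fin (suc (suc k))) → det (λ i j → pair (rest i) (w (σ j)))
        inner outer : Fin (suc (suc k)) → Fin (suc k) → Carrier
        inner j l = ε l * (x (punchIn j l) * W (punchIn j ∘ punchIn l))
        outer j l = ε j * (ε l * ((x j * x (punchIn j l)) * W (punchIn j ∘ punchIn l)))

-- Differences of indices modulo n.

module _ {m : ℕ} where
  private n = suc m

  toℕ-mod : ∀ k → toℕ (k mod n) ≡ k % n
  toℕ-mod k = Finₚ.toℕ-fromℕ< (m%n<n k n)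

  mod-cong : ∀ k l → k % n ≡ l % n → k mod n ≡ l mod n
  mod-cong k l e =
    Finₚ.toℕ-injective (≡.trans (toℕ-mod k) (≡.trans e (≡.sym (toℕ-mod l))))

  mod-toℕ : ∀ (j : Fin n) → toℕ j mod n ≡ j
  mod-toℕ j = Finₚ.toℕ-injective (≡.trans (toℕ-mod (toℕ j)) (m<n⇒m%n≡m (Finₚ.toℕ<n j)))

  diffMod-spec : ∀ (i j : Fin n) → (toℕ i ℕ.+ toℕ (diffMod i j)) mod n ≡ j
  diffMod-spec i j = ≡.trans (mod-cong (toℕ i ℕ.+ toℕ (diffMod i j)) (toℕ j) residues) (mod-toℕ j)
    where
    open ≡.≡-Reasoning
    d = (toℕ j ℕ.+ n) ∸ toℕ i
    i≤j+n : toℕ i ≤ toℕ j ℕ.+ n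
    i≤j+n = ℕₚ.≤-trans (ℕₚ.<⇒≤ (Finₚ.toℕ<n i)) (ℕₚ.m≤n+m n (toℕ j))
    residues : (toℕ i ℕ.+ toℕ (diffMod i j)) % n ≡ toℕ j % n
    residues = begin
      (toℕ i ℕ.+ toℕ (d mod n)) % n  ≡⟨ ≡.cong (λ x → (toℕ i ℕ.+ x) % n) (toℕ-mod d) ⟩
      (toℕ i ℕ.+ d % n) % n          ≡⟨ %-distribˡ-+ (toℕ i) (d % n) n ⟩
      (toℕ i % n ℕ.+ d % n % n) % n  ≡⟨ ≡.cong (λ x → (toℕ i % n ℕ.+ x) % n) (m%n%n≡m%n d n) ⟩
      (toℕ i % n ℕ.+ d % n) % n      ≡⟨ %-distribˡ-+ (toℕ i) d n ⟨
      (toℕ i ℕ.+ d) % n              ≡⟨ ≡.cong (_% n) (ℕₚ.m+[n∸m]≡n i≤j+n) ⟩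
      (toℕ j ℕ.+ n) % n              ≡⟨ [m+n]%n≡m%n (toℕ j) n ⟩
      toℕ j % n                      ∎

  -- Both indices are below n, so i + k wraps around at most once; this gives the two cases.
  -- Together with `diffMod-spec`, each column j is hit from row i by exactly one coefficient.
  diffMod-unique : ∀ (i k : Fin n) → k ≡ diffMod i ((toℕ i ℕ.+ toℕ k) mod n)
  diffMod-unique i k = ≡.trans (≡.sym (mod-toℕ k)) (mod-cong (toℕ k) ((toℕ (s mod n) ℕ.+ n) ∸ toℕ i) (≡.sym residues))
    where
    open ≡.≡-Reasoning
    s = toℕ i ℕ.+ toℕ k
    residues : ((toℕ (s mod n) ℕ.+ n) ∸ toℕ i) % n ≡ toℕ k % n
    residues with s ℕ.<? n
    ... | yes s<n = begin
      ((toℕ (s mod n) ℕ.+ n) ∸ toℕ i) % n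
        ≡⟨ ≡.cong (λ x → ((x ℕ.+ n) ∸ toℕ i) % n) (≡.trans (toℕ-mod s) (m<n⇒m%n≡m s<n)) ⟩
      ((toℕ i ℕ.+ toℕ k ℕ.+ n) ∸ toℕ i) % n
        ≡⟨ ≡.cong (λ x → (x ∸ toℕ i) % n) (ℕₚ.+-assoc (toℕ i) (toℕ k) n) ⟩
      ((toℕ i ℕ.+ (toℕ k ℕ.+ n)) ∸ toℕ i) % n
        ≡⟨ ≡.cong (_% n) (ℕₚ.m+n∸m≡n (toℕ i) (toℕ k ℕ.+ n)) ⟩
      (toℕ k ℕ.+ n) % n              ≡⟨ [m+n]%n≡m%n (toℕ k) n ⟩
      toℕ k % n                      ∎
    ... | no s≮n = begin
      ((toℕ (s mod n) ℕ.+ n) ∸ toℕ i) % n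
        ≡⟨ ≡.cong (λ x → ((x ℕ.+ n) ∸ toℕ i) % n) (≡.trans (toℕ-mod s)
             (≡.trans (≡.sym (m≤n⇒[n∸m]%m≡n%m n≤s)) (m<n⇒m%n≡m s∸n<n))) ⟩
      (((s ∸ n) ℕ.+ n) ∸ toℕ i) % n  ≡⟨ ≡.cong (λ x → (x ∸ toℕ i) % n) (ℕₚ.m∸n+n≡m n≤s) ⟩
      (s ∸ toℕ i) % n                ≡⟨ ≡.cong (_% n) (ℕₚ.m+n∸m≡n (toℕ i) (toℕ k)) ⟩
      toℕ k % n                      ∎
      where
      n≤s = ℕₚ.≮⇒≥ s≮n
      s∸n<n : s ∸ n < n
      s∸n<n = ℕₚ.≤-<-trans (ℕₚ.m≤n+o⇒m∸n≤o s n
        (ℕₚ.+-monoˡ-≤ (toℕ k) (ℕₚ.<⇒≤ (Finₚ.toℕ<n i)))) (Finₚ.toℕ<n k)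

-- Leading minors of circulant matrices.

module Circulants {c ℓ} (R : CommutativeRing c ℓ) where
  open CommutativeRing R hiding (zero)
  open Ops R
  open Sums R
  open Polynomials R
  open Degrees R
  open Pairings R
  open Determinants R
  private module P = CommutativeRing polyRing
  open import Relation.Binary.Reasoning.Setoid setoid
  open import Algebra.Properties.Ring ring using (-1*x≈-x; -‿distribˡ-*; -‿involutive)
  open import Algebra.Properties.CommutativeSemigroup P.*-commutativeSemigroup
    using () renaming (x∙yz≈xy∙z to ⊗-x∙yz≈xy∙z)
  open import Algebra.Solver.Ring.NaturalCoefficients.Default commutativeSemiring
    using (solve; _:*_; _:=_)

  indicator : ∀ {n} → Fin n → Fin n → Carrier
  indicator i j = if does (i Fin.≟ j) then 1# else 0#

  indicator-≡ : ∀ {n} {i j : Fin n} → i ≡ j → indicator i j ≈ 1#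
  indicator-≡ {i = i} {j} e with i Fin.≟ j
  ... | yes _  = refl
  ... | no i≢j = contradiction e i≢j

  indicator-≢ : ∀ {n} {i j : Fin n} → i ≢ j → indicator i j ≈ 0#
  indicator-≢ {i = i} {j} i≢j with i Fin.≟ j
  ... | yes e = contradiction e i≢j
  ... | no _  = refl

  -- As a functional this is coefficient j of the remainder modulo x^n - 1.
  residue : ∀ {n} → Fin n → ℕ → Carrier
  residue {suc m} j k = indicator (k mod suc m) j

  residue-periodic : ∀ {n} (j : Fin n) → Periodic n (residue j)
  residue-periodic {suc m} j k =
    reflexive (≡.cong (λ i → indicator i j) (mod-cong (k ℕ.+ suc m) k ([m+n]%n≡m%n k (suc m))))

  residue-≢ : ∀ {n} (j : Fin n) {k} → k < n → k ≢ toℕ j → residue j k ≈ 0#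
  residue-≢ {suc m} j {k} k<n k≢j = indicator-≢ λ e → k≢j (≡.trans
    (≡.sym (≡.trans (toℕ-mod k) (m<n⇒m%n≡m k<n))) (≡.cong toℕ e))

  residue-toℕ : ∀ {n} (j : Fin n) → residue j (toℕ j) ≈ 1#
  residue-toℕ {suc m} j = indicator-≡ (mod-toℕ j)

  pair-tabulate : ∀ {n} (a : Fin n → Carrier) w →
    pair (List.tabulate a) w ≈ sumF (λ k → a k * w (toℕ k))
  pair-tabulate {zero}  a w = refl
  pair-tabulate {suc n} a w = +-congˡ (pair-tabulate (a ∘ Fin.suc) (w ∘ suc))

  pair-circulant : ∀ {n} (a : Fin n → Carrier) i j →
    pair (List.tabulate a) (λ k → residue j (toℕ i ℕ.+ k)) ≈ a (diffMod i j)
  pair-circulant {suc m} a i j = begin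
    pair (List.tabulate a) (λ k → residue j (toℕ i ℕ.+ k))   ≈⟨ pair-tabulate a (λ k → residue j (toℕ i ℕ.+ k)) ⟩
    sumF entry                                             ≈⟨ sumF-single entry (diffMod i j) others ⟩
    a (diffMod i j) * residue j (toℕ i ℕ.+ toℕ (diffMod i j))
      ≈⟨ trans (*-congˡ (indicator-≡ (diffMod-spec i j))) (*-identityʳ _) ⟩
    a (diffMod i j)                                        ∎
    where
    entry = λ k → a k * residue j (toℕ i ℕ.+ toℕ k)
    others : ∀ k → k ≢ diffMod i j → entry k ≈ 0#
    others k k≢ = trans (*-congˡ (indicator-≢
      (λ e → k≢ (≡.trans (diffMod-unique i k) (≡.cong (diffMod i) e))))) (zeroʳ _)

  pair-X^⊗ : ∀ i p w → pair (Ops.pow polyRing X i ⊗ p) w ≈ pair p (λ k → w (i ℕ.+ k))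
  pair-X^⊗ zero    p w = pair-cong (𝟙 ⊗ p) p (P.*-identityˡ p) (λ _ → refl)
  pair-X^⊗ (suc i) p w = trans
    (pair-cong (X ⊗ Ops.pow polyRing X i ⊗ p) _ (P.*-assoc X _ p) (λ _ → refl))
    (trans (pair-X⊗ _ w) (pair-X^⊗ i p (w ∘ suc)))

  pair-single : ∀ p w k → (∀ l → l ≢ k → coeff p l * w l ≈ 0#) → pair p w ≈ coeff p k * w k
  pair-single []      w k       e = sym (zeroˡ _)
  pair-single (a ∷ p) w zero    e =
    trans (+-congˡ (pair-zero p _ (λ l → e (suc l) λ ()))) (+-identityʳ _)
  pair-single (a ∷ p) w (suc k) e = trans
    (+-cong (e 0 λ ()) (pair-single p (w ∘ suc) k (λ l l≢k → e (suc l) (l≢k ∘ ℕₚ.suc-injective))))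
    (+-identityˡ _)

  pair-residue : ∀ {n} p (j : Fin n) → Vanishing n p → pair p (residue j) ≈ coeff p (toℕ j)
  pair-residue {n} p j v = trans (pair-single p _ (toℕ j) others)
    (trans (*-congˡ (residue-toℕ j)) (*-identityʳ _))
    where
    others : ∀ l → l ≢ toℕ j → coeff p l * residue j l ≈ 0#
    others l l≢j with l ℕ.<? n
    ... | yes l<n = trans (*-congˡ (residue-≢ j l<n l≢j)) (zeroʳ _)
    ... | no l≮n  = trans (*-congʳ (v l (ℕₚ.≮⇒≥ l≮n))) (zeroˡ _)

  -- Valid for any factorisation ∏ (x - ω_i) D = x^n - 1, so that `D` can be the gcd as well as 1.
  -- The bound deg D ≤ n - r keeps x^i D for i < r below degree n: nothing wraps around, and the
  -- entries in the first r columns are triangular.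
  leading-circulant-determinant : ∀ {n r} (r≤n : r ≤ n) (a : Fin n → Carrier) (ω : Fin r → Carrier) D G E →
    Vanishing (suc (n ∸ r)) D → prodP (λ i → linear (ω i)) ⊗ D ≋ xⁿ-1 n →
    List.tabulate a ≋ G ⊗ D ⊕ E ⊗ xⁿ-1 n →
    det (leading r r≤n (λ i j → a (diffMod i j))) ≈ prodF (λ i → eval G (ω i)) * pow (coeff D 0) r
  leading-circulant-determinant {n} {r} r≤n a ω D G E D-small factorisation L≋ = begin
    det (leading r r≤n (λ i j → a (diffMod i j)))
      ≈⟨ det-cong {N = entries (G ⊗ D)} same-entries ⟩
    det (entries (G ⊗ D))
      ≈⟨ multiplication-determinant r
           (pairing-determinant-alternating r w (λ j → residue-periodic (inject≤ j r≤n)))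
           ω G D 𝟙 (P.trans factorisation (P.sym (P.*-identityˡ _))) ⟩
    prodF (λ i → eval G (ω i)) * det (entries D)
      ≈⟨ *-congˡ (trans (det-triangular (entries D) below) (trans
           (prodF-cong diagonal) (prodF-const r _))) ⟩
    prodF (λ i → eval G (ω i)) * pow (coeff D 0) r ∎
    where
    open AlternatingForms R (xⁿ-1 n)
    z = xⁿ-1 n
    w : Fin r → ℕ → Carrier
    w j = residue (inject≤ j r≤n)
    entries : Poly → Matrix r r
    entries Q i j = pair (multiples Q i) (w j)

    same-entries : ∀ i j → a (diffMod (inject≤ i r≤n) (inject≤ j r≤n)) ≈ entries (G ⊗ D) i j
    same-entries i j = begin
      a (diffMod (inject≤ i r≤n) (inject≤ j r≤n))   ≈⟨ pair-circulant a _ _ ⟨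
      pair L (λ k → w j (toℕ (inject≤ i r≤n) ℕ.+ k))
        ≈⟨ pair-cong L L P.refl (λ k →
             reflexive (≡.cong (λ x → w j (x ℕ.+ k)) (Finₚ.toℕ-inject≤ i r≤n))) ⟩
      pair L (λ k → w j (toℕ i ℕ.+ k))              ≈⟨ pair-X^⊗ (toℕ i) L (w j) ⟨
      pair (multiples L i) (w j)
        ≈⟨ pair-cong (multiples L i) _ (P.trans (P.*-congˡ L≋) (P.trans (P.distribˡ _ _ _)
             (P.+-congˡ (⊗-x∙yz≈xy∙z _ _ _)))) (λ _ → refl) ⟩
      pair (multiples (G ⊗ D) i ⊕ (X^ toℕ i ⊗ E) ⊗ z) (w j)
        ≈⟨ pair-⊕ (multiples (G ⊗ D) i) _ (w j) ⟩
      entries (G ⊗ D) i j + pair ((X^ toℕ i ⊗ E) ⊗ z) (w j)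
        ≈⟨ trans (+-congˡ (pair-periodic n (X^ toℕ i ⊗ E) (w j) (residue-periodic (inject≤ j r≤n))))
             (+-identityʳ _) ⟩
      entries (G ⊗ D) i j                           ∎
      where L = List.tabulate a

    off-diagonal : ∀ (i j : Fin r) k → toℕ i ℕ.+ k ≢ toℕ j →
      coeff D k * w j (toℕ i ℕ.+ k) ≈ 0#
    off-diagonal i j k ≢j with k ℕ.≤? n ∸ r
    ... | no k≰  = trans (*-congʳ (D-small k (ℕₚ.≰⇒> k≰))) (zeroˡ _)
    ... | yes k≤ = trans (*-congˡ (residue-≢ (inject≤ j r≤n)
      (≡.subst (toℕ i ℕ.+ k <_) (ℕₚ.m+[n∸m]≡n r≤n) (ℕₚ.+-mono-<-≤ (Finₚ.toℕ<n i) k≤))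
      (λ e → ≢j (≡.trans e (Finₚ.toℕ-inject≤ j r≤n))))) (zeroʳ _)

    below : ∀ i j → toℕ j < toℕ i → entries D i j ≈ 0#
    below i j j<i = trans (pair-X^⊗ (toℕ i) D (w j)) (pair-zero D _ (λ k →
      off-diagonal i j k (λ e → ℕₚ.<⇒≱ j<i (≡.subst (toℕ i ≤_) e (ℕₚ.m≤m+n (toℕ i) k)))))

    diagonal : ∀ i → entries D i i ≈ coeff D 0
    diagonal i = trans (pair-X^⊗ (toℕ i) D (w i)) (trans
      (pair-single D _ 0 (λ l l≢0 → off-diagonal i i l
        (λ e → l≢0 (ℕₚ.+-cancelˡ-≡ (toℕ i) l 0 (≡.trans e (≡.sym (ℕₚ.+-identityʳ (toℕ i))))))))
      (trans (*-congˡ (trans (reflexive (≡.cong (w i)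
          (≡.trans (ℕₚ.+-identityʳ (toℕ i)) (≡.sym (Finₚ.toℕ-inject≤ i r≤n)))))
        (residue-toℕ (inject≤ i r≤n)))) (*-identityʳ _)))

  sign-cases : ∀ k → sign k ≈ 1# ⊎ sign k ≈ - 1#
  sign-cases zero = inj₁ refl
  sign-cases (suc k) with sign-cases k
  ... | inj₁ e = inj₂ (-‿cong e)
  ... | inj₂ e = inj₁ (trans (-‿cong e) (-‿involutive 1#))

  pow--1 : ∀ k → pow (- 1#) k ≈ sign k
  pow--1 zero    = refl
  pow--1 (suc k) = trans (-1*x≈-x _) (-‿cong (pow--1 k))

  -- The numbers k · k and k have the same parity.
  pow-sign : ∀ k → pow (sign k) k ≈ sign k
  pow-sign k with sign-cases k
  ... | inj₁ e = trans (pow-cong k e) (trans (pow-one k) (sym e))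
  ... | inj₂ e = trans (pow-cong k e) (pow--1 k)

  sign-square : ∀ k → sign k * sign k ≈ 1#
  sign-square zero    = *-identityˡ 1#
  sign-square (suc k) = trans (sym (-‿distribˡ-* _ _))
    (trans (-‿cong (trans (*-comm _ _) (sym (-‿distribˡ-* _ _))))
      (trans (-‿involutive _) (sign-square k)))

  coeff-prodP-zero : ∀ {r} (ω : Fin r → Carrier) →
    coeff (prodP (λ i → linear (ω i))) 0 ≈ sign r * prodF ω
  coeff-prodP-zero {zero}  ω = sym (*-identityˡ 1#)
  coeff-prodP-zero {suc r} ω = begin
    coeff (linear a *P prodP (λ i → linear (ω (Fin.suc i)))) 0
      ≈⟨ coeff-*P-zero (linear a) (prodP (λ i → linear (ω (Fin.suc i)))) ⟩
    (0# - a) * coeff (prodP (λ i → linear (ω (Fin.suc i)))) 0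
      ≈⟨ *-cong (+-identityˡ _) (coeff-prodP-zero (ω ∘ Fin.suc)) ⟩
    - a * (sign r * prodF (ω ∘ Fin.suc))   ≈⟨ -‿distribˡ-* _ _ ⟨
    - (a * (sign r * prodF (ω ∘ Fin.suc)))
      ≈⟨ -‿cong (solve 3 (λ a s p → a :* (s :* p) := s :* (a :* p)) refl _ _ _) ⟩
    - (sign r * (a * prodF (ω ∘ Fin.suc))) ≈⟨ -‿distribˡ-* _ _ ⟩
    - sign r * (a * prodF (ω ∘ Fin.suc))   ∎
    where a = ω Fin.zero

  -- Comparing constant terms gives (-1)^r Π d = -1. In the r-th power the sign on the left becomes
  -- (-1)^(r·r) = (-1)^r, the same as on the right, so the two signs cancel.
  constant-term-power : ∀ {n r} → 0 < n → (ω : Fin r → Carrier) (D : Poly) →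
    prodP (λ i → linear (ω i)) ⊗ D ≋ xⁿ-1 n →
    prodF (λ i → pow (ω i) r) * pow (coeff D 0) r ≈ 1#
  constant-term-power {suc m} {r} _ ω D e = begin
    prodF (λ i → pow (ω i) r) * pow d r        ≈⟨ *-congʳ (pow-prodF ω r) ⟨
    pow Π r * pow d r                          ≈⟨ pow-* Π d r ⟨
    pow (Π * d) r                              ≈⟨ trans (*-congʳ (sign-square r)) (*-identityˡ _) ⟨
    sign r * sign r * pow (Π * d) r            ≈⟨ *-congʳ (*-congˡ (pow-sign r)) ⟨
    sign r * pow (sign r) r * pow (Π * d) r    ≈⟨ *-assoc _ _ _ ⟩
    sign r * (pow (sign r) r * pow (Π * d) r)  ≈⟨ *-congˡ (pow-* (sign r) (Π * d) r) ⟨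
    sign r * pow (sign r * (Π * d)) r          ≈⟨ *-congˡ (trans (pow-cong r norm) (pow--1 r)) ⟩
    sign r * sign r                            ≈⟨ sign-square r ⟩
    1#                                         ∎
    where
    d = coeff D 0
    Π = prodF ω
    norm : sign r * (Π * d) ≈ - 1#
    norm = trans (sym (*-assoc _ _ _)) (trans (*-congʳ (sym (coeff-prodP-zero ω)))
      (trans (sym (coeff-⊗-zero (prodP (λ i → linear (ω i))) D)) (at e 0)))

-- Finite fields: decidable equality and a^q = a.

module FiniteFields {c ℓ} (F : Field c ℓ) (q : ℕ) (size : HasSize F q) where
  open Field F hiding (zero)
  open Ops commutativeRing
  open Sums commutativeRing
  open import Relation.Binary.Reasoning.Setoid setoid
  open import Algebra.Properties.Semiring.Exp semiring using (_^_; ^-assocʳ)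
  open import Algebra.Properties.CommutativeMonoid.Sum *-commutativeMonoid
    using () renaming (sum to product; sum-permute to product-permute)

  enum : Fin q → Carrier
  enum = proj₁ size

  enum-injective : ∀ {i j} → enum i ≈ enum j → i ≡ j
  enum-injective = proj₁ (proj₂ size) _ _

  index : Carrier → Fin q
  index x = proj₁ (proj₂ (proj₂ size) x)

  enum-index : ∀ x → enum (index x) ≈ x
  enum-index x = proj₂ (proj₂ (proj₂ size) x)

  index-cong : ∀ {x y} → x ≈ y → index x ≡ index y
  index-cong e = enum-injective (trans (enum-index _) (trans e (sym (enum-index _))))

  index-injective : ∀ {x y} → index x ≡ index y → x ≈ y
  index-injective e = trans (sym (enum-index _)) (trans (reflexive (≡.cong enum e)) (enum-index _))

  infix 4 _≈?_
  _≈?_ : ∀ x y → Dec (x ≈ y)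
  x ≈? y = map′ index-injective index-cong (index x Fin.≟ index y)

  1<q : 1 < q
  1<q = two (index 1#) (index 0#) (1≉0 ∘ index-injective)
    where
    two : ∀ {m} (i j : Fin m) → i ≢ j → 1 < m
    two {suc zero}    Fin.zero Fin.zero i≢j = contradiction ≡.refl i≢j
    two {suc (suc m)} i        j        i≢j = s≤s (s≤s z≤n)

  inverseˡ : ∀ x → ¬ (x ≈ 0#) → x ⁻¹ * x ≈ 1#
  inverseˡ x x≉0 = trans (*-comm _ _) (inverseʳ x x≉0)

  *-cancelʳ : ∀ x y z → ¬ (z ≈ 0#) → x * z ≈ y * z → x ≈ y
  *-cancelʳ x y z z≉0 e = begin
    x              ≈⟨ trans (*-congˡ (inverseʳ z z≉0)) (*-identityʳ x) ⟨
    x * (z * z ⁻¹) ≈⟨ *-assoc _ _ _ ⟨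
    x * z * z ⁻¹   ≈⟨ *-congʳ e ⟩
    y * z * z ⁻¹   ≈⟨ *-assoc _ _ _ ⟩
    y * (z * z ⁻¹) ≈⟨ trans (*-congˡ (inverseʳ z z≉0)) (*-identityʳ y) ⟩
    y              ∎

  prodF≉0 : ∀ {k} (f : Fin k → Carrier) → (∀ i → ¬ (f i ≈ 0#)) → ¬ (prodF f ≈ 0#)
  prodF≉0 {zero}  f f≉0 = 1≉0
  prodF≉0 {suc k} f f≉0 e = f≉0 Fin.zero (*-cancelʳ _ _ (prodF (f ∘ Fin.suc))
    (prodF≉0 (f ∘ Fin.suc) (f≉0 ∘ Fin.suc)) (trans e (sym (zeroˡ _))))

  prodF≡product : ∀ {k} (f : Fin k → Carrier) → prodF f ≡ product f
  prodF≡product {zero}  f = ≡.refl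
  prodF≡product {suc k} f = ≡.cong (f Fin.zero *_) (prodF≡product (f ∘ Fin.suc))

  pow≡^ : ∀ x k → pow x k ≡ x ^ k
  pow≡^ x zero    = ≡.refl
  pow≡^ x (suc k) = ≡.cong (x *_) (pow≡^ x k)

  pow-pow : ∀ x m k → pow x (m ℕ.* k) ≈ pow (pow x m) k
  pow-pow x m k rewrite pow≡^ x (m ℕ.* k) | pow≡^ x m | pow≡^ (x ^ m) k = sym (^-assocʳ x m k)

  -- Multiplication by a ≠ 0 permutes the field. Replacing the factor 0 by 1 in the
  -- product Π of all elements gives a Π = a ^ q Π with Π ≠ 0.
  module _ (a : Carrier) (a≉0 : ¬ (a ≈ 0#)) where
    private
      scaling : Permutation q q
      scaling = permutation (λ i → index (a * enum i)) (λ i → index (a ⁻¹ * enum i))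
        (λ i → cancel (inverseʳ a a≉0)) (λ i → cancel (inverseˡ a a≉0))
        where
        cancel : ∀ {x y i} → x * y ≈ 1# → index (x * enum (index (y * enum i))) ≡ i
        cancel e = enum-injective (trans (enum-index _) (trans (*-congˡ (enum-index _))
          (trans (sym (*-assoc _ _ _)) (trans (*-congʳ e) (*-identityˡ _)))))

      0↦1 : Carrier → Carrier
      0↦1 x with x ≈? 0#
      ... | yes _ = 1#
      ... | no  _ = x

      nonzero : Fin q → Carrier
      nonzero i = 0↦1 (enum i)

      -- Compares the two products at the index of 0: there a times the substitute 1 is `a`, while
      -- the scaled 0 is again replaced by 1. The product of all corrections is therefore a single
      -- `a`.
      correction : Fin q → Carrier
      correction i with enum i ≈? 0#
      ... | yes _ = a
      ... | no  _ = 1#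

      nonzero≉0 : ∀ i → ¬ (nonzero i ≈ 0#)
      nonzero≉0 i with enum i ≈? 0#
      ... | yes _ = 1≉0
      ... | no e  = e

      0↦1-cong : ∀ {x x′} → x ≈ x′ → 0↦1 x ≈ 0↦1 x′
      0↦1-cong {x} {x′} e with x ≈? 0# | x′ ≈? 0#
      ... | yes _   | yes _    = refl
      ... | no _    | no _     = e
      ... | yes x≈0 | no x′≉0  = contradiction (trans (sym e) x≈0) x′≉0
      ... | no x≉0  | yes x′≈0 = contradiction (trans e x′≈0) x≉0

      scaled : ∀ i → correction i * 0↦1 (a * enum i) ≈ a * nonzero i
      scaled i with enum i ≈? 0# | a * enum i ≈? 0#
      ... | yes _ | yes _   = refl
      ... | no _  | no _    = *-identityˡ _
      ... | yes e | no ≉0   = contradiction (trans (*-congˡ e) (zeroʳ a)) ≉0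
      ... | no ≉0 | yes e   = contradiction
        (*-cancelʳ _ _ a a≉0 (trans (*-comm _ _) (trans e (sym (zeroˡ a))))) ≉0

      product-single : ∀ {k} (f : Fin k → Carrier) i → (∀ j → j ≢ i → f j ≈ 1#) → prodF f ≈ f i
      product-single f Fin.zero    e =
        trans (*-congˡ (prodF-one (λ j → e (Fin.suc j) λ ()))) (*-identityʳ _)
      product-single f (Fin.suc i) e =
        trans (*-cong (e Fin.zero λ ())
          (product-single (f ∘ Fin.suc) i (λ j j≢i → e (Fin.suc j) (j≢i ∘ Finₚ.suc-injective))))
          (*-identityˡ _)

      prodF-correction : prodF correction ≈ a
      prodF-correction = trans (product-single correction (index 0#) others) here
        where
        others : ∀ j → j ≢ index 0# → correction j ≈ 1#
        others j j≢0 with enum j ≈? 0#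
        ... | yes e = contradiction (enum-injective (trans e (sym (enum-index 0#)))) j≢0
        ... | no _  = refl
        here : correction (index 0#) ≈ a
        here with enum (index 0#) ≈? 0#
        ... | yes _ = refl
        ... | no ≉0 = contradiction (enum-index 0#) ≉0

      nonzero-permuted : prodF nonzero ≈ prodF (λ i → 0↦1 (a * enum i))
      nonzero-permuted = begin
        prodF nonzero                             ≡⟨ prodF≡product nonzero ⟩
        product nonzero                           ≈⟨ product-permute nonzero scaling ⟩
        product permuted                          ≡⟨ prodF≡product permuted ⟨
        prodF permuted
          ≈⟨ prodF-cong {f = permuted} {λ i → 0↦1 (a * enum i)}
               (λ i → 0↦1-cong (enum-index (a * enum i))) ⟩
        prodF (λ i → 0↦1 (a * enum i))       ∎
        where
        permuted : Fin q → Carrier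
        permuted i = nonzero (index (a * enum i))

    frobenius-nonzero : pow a q ≈ a
    frobenius-nonzero = *-cancelʳ _ _ (prodF nonzero) (prodF≉0 nonzero nonzero≉0) (begin
      pow a q * prodF nonzero               ≈⟨ *-congʳ (prodF-const q a) ⟨
      prodF {q} (λ _ → a) * prodF nonzero   ≈⟨ prodF-* (λ _ → a) nonzero ⟨
      prodF (λ i → a * nonzero i)           ≈⟨ prodF-cong scaled ⟨
      prodF (λ i → correction i * 0↦1 (a * enum i)) ≈⟨ prodF-* correction _ ⟩
      prodF correction * prodF (λ i → 0↦1 (a * enum i))
        ≈⟨ *-cong prodF-correction (sym nonzero-permuted) ⟩
      a * prodF nonzero                     ∎)

  frobenius : ∀ a → pow a q ≈ a
  frobenius a with a ≈? 0#
  ... | no a≉0  = frobenius-nonzero a a≉0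
  ... | yes a≈0 = positive q (ℕₚ.<⇒≤ 1<q)
    where
    positive : ∀ q → 0 < q → pow a q ≈ a
    positive (suc q) _ = trans (*-congʳ a≈0) (trans (zeroˡ _) (sym a≈0))

  frobenius-iterated : ∀ a k → pow a (q ℕ.^ k) ≈ a
  frobenius-iterated a zero    = *-identityʳ a
  frobenius-iterated a (suc k) =
    trans (pow-pow a q (q ℕ.^ k)) (trans (pow-cong (q ℕ.^ k) (frobenius a)) (frobenius-iterated a k))

-- The rank of a circulant matrix over a finite field.

module CirculantRank {c ℓ} (F : Field c ℓ) (q : ℕ) (size : HasSize F q) where
  open Field F hiding (zero)
  open Ops commutativeRing
  open Sums commutativeRing
  open Polynomials commutativeRing
  open Degrees commutativeRing
  open Pairings commutativeRing
  open Circulants commutativeRing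
  open FiniteFields F q size
  private
    module P = CommutativeRing polyRing
    module PSums = Sums polyRing
    module POps = Ops polyRing
  open import Algebra.Properties.Ring ring using (x∙y⁻¹≈ε⇒x≈y)
  open import Algebra.Properties.Ring P.ring using () renaming ([y-z]x≈yx-zx to [q-r]p≋qp-rp)

  infix 4 _∣_
  _∣_ : Poly → Poly → Set _
  d ∣ p = ∃[ e ] e ⊗ d ≋ p

  remainder-≋ : ∀ {p q f r} → p ≋ q ⊗ f ⊕ r → r ≋ p ⊕ ⊖ (q ⊗ f)
  remainder-≋ {p} {q} {f} {r} e = P.sym (P.trans (P.+-congʳ (P.trans e (P.+-comm _ _)))
    (P.trans (P.+-assoc _ _ _) (P.trans (P.+-congˡ (P.-‿inverseʳ _)) (P.+-identityʳ _))))

  leading-coefficient : ∀ k p → Vanishing k p →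
    p ≋ 𝟘 ⊎ ∃[ l ] (l < k × ¬ (coeff p l ≈ 0#) × Vanishing (suc l) p)
  leading-coefficient zero    p v = inj₁ (vanishing-0 v)
  leading-coefficient (suc k) p v with coeff p k ≈? 0#
  ... | no ≉0 = inj₂ (k , ℕₚ.≤-refl , ≉0 , v)
  ... | yes e with leading-coefficient k p smaller
    where
    smaller : Vanishing k p
    smaller j k≤j with k ℕ.≟ j
    ... | yes ≡.refl = e
    ... | no k≢j     = v j (ℕₚ.≤∧≢⇒< k≤j k≢j)
  ... | inj₁ p≋𝟘                = inj₁ p≋𝟘
  ... | inj₂ (l , l<k , ≉0 , u) = inj₂ (l , ℕₚ.m≤n⇒m≤1+n l<k , ≉0 , u)

  normalise : ∀ {l} p → ¬ (coeff p l ≈ 0#) → Vanishing (suc l) p →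
    Monic l (constP (coeff p l ⁻¹) ⊗ p)
  normalise {l} p ≉0 v =
      trans (coeff-constP⊗ _ p l) (inverseˡ _ ≉0)
    , λ k l<k → trans (coeff-constP⊗ _ p k) (trans (*-congˡ (v k l<k)) (zeroʳ _))

  module _ {n r : ℕ} (r≤n : r ≤ n) (L D z : Poly) (monic-z : Monic n z) (monic-D : Monic (n ∸ r) D)
    (greatest : ∀ e → e ∣ L → e ∣ z → e ∣ D) where

    -- A monic p of least degree with z ∣ pL divides z; the cofactor of p then
    -- divides both L and z, hence D, which forces deg p ≥ r.
    no-monic-annihilator : ∀ b k → k < b → k < r → ∀ p → Monic k p → ¬ (z ∣ p ⊗ L)
    no-monic-annihilator (suc b) k (s≤s k≤b) k<r p monic-p@(p-lead , p-small) (m , mz≋pL)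
      with divide p monic-p z
    ... | p′ , ρ , z≋ , ρ-small with leading-coefficient k ρ ρ-small
    -- A nonzero remainder ρ = z - p′ p satisfies ρ L = (L - p′ m) z. Made monic, it is an
    -- annihilator of smaller degree, and `b` measures the descent.
    ...   | inj₂ (l , l<k , ≉0 , v) = no-monic-annihilator b l (ℕₚ.≤-trans l<k k≤b)
      (ℕₚ.<-trans l<k k<r) (u ⊗ ρ) (normalise ρ ≉0 v)
      (u ⊗ (L ⊕ ⊖ (p′ ⊗ m)) , P.trans (P.*-assoc _ _ _) (P.trans (P.*-congˡ (P.sym ρL≋)) (P.sym (P.*-assoc _ _ _))))
      where
      u = constP (coeff ρ l ⁻¹)
      ρL≋ : ρ ⊗ L ≋ (L ⊕ ⊖ (p′ ⊗ m)) ⊗ z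
      ρL≋ = P.trans (P.*-congʳ (remainder-≋ z≋)) (P.trans ([q-r]p≋qp-rp L z (p′ ⊗ p))
        (P.trans (P.+-cong (P.*-comm z L) (P.-‿cong (P.trans (P.*-assoc p′ p L)
          (P.trans (P.*-congˡ (P.sym mz≋pL)) (P.sym (P.*-assoc p′ m z))))))
          (P.sym ([q-r]p≋qp-rp z L (p′ ⊗ m)))))
    -- Now z = p′ p, and cancelling p in p L = m z gives L = m p′. Writing D = e p′ yields D p = e
    -- z, where deg (D p) ≤ (n - r) + k < n forces e = 0 and then D = 0, against monicity.
    ...   | inj₁ ρ≋𝟘 = 1≉0 (trans (sym (proj₁ monic-D)) (D-small (n ∸ r) z≤n))
      where
      z≋p′p : z ≋ p′ ⊗ p
      z≋p′p = P.trans z≋ (P.trans (P.+-congˡ ρ≋𝟘) (P.+-identityʳ _))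
      mp′≋L : m ⊗ p′ ≋ L
      mp′≋L = monic-cancel p (m ⊗ p′) L monic-p (P.trans (P.*-assoc m p′ p)
        (P.trans (P.*-congˡ (P.sym z≋p′p)) (P.trans mz≋pL (P.*-comm p L))))
      e : p′ ∣ D
      e = greatest p′ (m , mp′≋L) (p , P.trans (P.*-comm p p′) (P.sym z≋p′p))
      Dp≋ : proj₁ e ⊗ z ≋ D ⊗ p
      Dp≋ = P.trans (P.*-congˡ z≋p′p) (P.trans (P.sym (P.*-assoc _ p′ p)) (P.*-congʳ (proj₂ e)))
      bound : suc (n ∸ r) ℕ.+ k ≤ n ℕ.+ 0
      bound = ≡.subst₂ _≤_ (ℕₚ.+-suc (n ∸ r) k) (≡.trans (ℕₚ.m∸n+n≡m r≤n) (≡.sym (ℕₚ.+-identityʳ n)))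
        (ℕₚ.+-monoʳ-≤ (n ∸ r) k<r)
      e≋𝟘 : Vanishing 0 (proj₁ e)
      e≋𝟘 = quotient-vanishing 0 z (proj₁ e) monic-z (λ j le → vanishing-cong (P.sym Dp≋)
        (vanishing-⊗ D p (proj₂ monic-D) p-small) j (ℕₚ.≤-trans bound le))
      D-small : Vanishing 0 D
      D-small = quotient-vanishing 0 p D monic-p (λ j _ → vanishing-cong Dp≋
        (vanishing-𝟘⊗ 0 z e≋𝟘) j z≤n)

    annihilator-vanishes : ∀ p → Vanishing r p → z ∣ p ⊗ L → p ≋ 𝟘
    annihilator-vanishes p v (m , mz≋pL) with leading-coefficient r p v
    ... | inj₁ p≋𝟘 = p≋𝟘
    ... | inj₂ (l , l<r , ≉0 , u) = ⊥-elim (no-monic-annihilator (suc l) l ℕₚ.≤-refl l<r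
      (w ⊗ p) (normalise p ≉0 u)
      (w ⊗ m , P.trans (P.*-assoc w m z) (P.trans (P.*-congˡ mz≋pL) (P.sym (P.*-assoc w p L)))))
      where w = constP (coeff p l ⁻¹)

  coeff-tabulate : ∀ {m} (a : Fin m → Carrier) i → coeff (List.tabulate a) (toℕ i) ≈ a i
  coeff-tabulate a Fin.zero    = refl
  coeff-tabulate a (Fin.suc i) = coeff-tabulate (a ∘ Fin.suc) i

  vanishing-tabulate : ∀ {m} (a : Fin m → Carrier) → Vanishing m (List.tabulate a)
  vanishing-tabulate {zero}  a k       _         = refl
  vanishing-tabulate {suc m} a (suc k) (s≤s m≤k) = vanishing-tabulate (a ∘ Fin.suc) k m≤k

  coeff-sumF : ∀ {k} (p : Fin k → Poly) j → coeff (POps.sumF p) j ≈ sumF (λ i → coeff (p i) j)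
  coeff-sumF {zero}  p j = coeff-𝟘 j
  coeff-sumF {suc k} p j =
    trans (coeff-⊕ (p Fin.zero) _ j) (+-congˡ (coeff-sumF (p ∘ Fin.suc) j))

  circulant : ∀ {n} → (Fin n → Carrier) → Matrix n n
  circulant a i j = a (diffMod i j)

  module _ {n : ℕ} (0<n : 0 < n) (a : Fin n → Carrier) where
    private
      L = List.tabulate a
      z = xⁿ-1 n
      monic-z = monic-xⁿ-1 0<n

    remainder-residue : ∀ p Q ρ → p ≋ Q ⊗ z ⊕ ρ → Vanishing n ρ → ∀ (j : Fin n) →
      coeff ρ (toℕ j) ≈ pair p (residue j)
    remainder-residue p Q ρ e v j = sym (trans (pair-cong p _ e (λ _ → refl))
      (trans (pair-⊕ (Q ⊗ z) ρ _) (trans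
        (+-cong (pair-periodic n Q _ (residue-periodic j)) (pair-residue ρ j v)) (+-identityˡ _))))

    pair-X^⊗-circulant : ∀ i j → pair (POps.pow X (toℕ i) ⊗ L) (residue j) ≈ circulant a i j
    pair-X^⊗-circulant i j = trans (pair-X^⊗ (toℕ i) L (residue j)) (pair-circulant a i j)

    leading-rows-independent : ∀ {r} (r≤n : r ≤ n) D → Monic (n ∸ r) D →
      (∀ e → e ∣ L → e ∣ z → e ∣ D) → RowsIndependent (circulant a) (λ (i : Fin r) → inject≤ i r≤n)
    leading-rows-independent {r} r≤n D monic-D greatest coef e t
      with divide z monic-z (List.tabulate coef ⊗ L)
    ... | Q , ρ , CL≋ , ρ-small = trans (sym (coeff-tabulate coef t)) (trans (at C≋𝟘 (toℕ t)) (coeff-𝟘 (toℕ t)))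
      where
      C = List.tabulate coef
      combination : ∀ j → pair (C ⊗ L) (residue j) ≈ 0#
      combination j = trans (pair-⊗ C L (residue j)) (trans (pair-tabulate coef _)
        (trans (sumF-cong (λ i → *-congˡ (trans
          (pair-cong L L P.refl (λ k → reflexive (≡.cong (λ x → residue j (x ℕ.+ k)) (≡.sym (Finₚ.toℕ-inject≤ i r≤n)))))
          (pair-circulant a (inject≤ i r≤n) j)))) (e j)))
      ρ≋𝟘 : Vanishing 0 ρ
      ρ≋𝟘 k _ with k ℕ.<? n
      ... | no k≮n  = ρ-small k (ℕₚ.≮⇒≥ k≮n)
      ... | yes k<n = trans (reflexive (≡.cong (coeff ρ) (≡.sym (Finₚ.toℕ-fromℕ< k<n))))
        (trans (remainder-residue (C ⊗ L) Q ρ CL≋ ρ-small (Fin.fromℕ< k<n)) (combination _))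
      C≋𝟘 : C ≋ 𝟘
      C≋𝟘 = annihilator-vanishes r≤n L D z monic-z monic-D greatest C (vanishing-tabulate coef)
        (Q , P.sym (P.trans CL≋ (P.trans (P.+-congˡ (vanishing-0 ρ≋𝟘)) (P.+-identityʳ _))))

    -- D divides both L and z, hence the remainder x^i L - Q z, with cofactor x^i l - Q e. The
    -- remainder has degree below n = (n - r) + r, which leaves degree below r for the cofactor.
    row-quotient : ∀ {r} → r ≤ n → ∀ D → Monic (n ∸ r) D → D ∣ L → D ∣ z → ∀ i →
      ∃[ w ] (Vanishing r w × ∀ j → coeff (w ⊗ D) (toℕ j) ≈ circulant a i j)
    row-quotient {r} r≤n D monic-D (l , lD≋L) (e , eD≋z) i
      with divide z monic-z (POps.pow X (toℕ i) ⊗ L)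
    ... | Q , ρ , XL≋ , ρ-small = w
      , quotient-vanishing r D w monic-D (λ j le → vanishing-cong ρ≋wD ρ-small j
          (≡.subst (_≤ j) (ℕₚ.m∸n+n≡m r≤n) le))
      , λ j → trans (sym (at ρ≋wD (toℕ j)))
          (trans (remainder-residue _ Q ρ XL≋ ρ-small j) (pair-X^⊗-circulant i j))
      where
      w = POps.pow X (toℕ i) ⊗ l ⊕ ⊖ (Q ⊗ e)
      ρ≋wD : ρ ≋ w ⊗ D
      ρ≋wD = P.trans (remainder-≋ XL≋) (P.sym (P.trans ([q-r]p≋qp-rp D _ _) (P.+-cong
        (P.trans (P.*-assoc _ l D) (P.*-congˡ lD≋L))
        (P.-‿cong (P.trans (P.*-assoc Q e D) (P.*-congˡ eD≋z))))))

  funToFin-cong : ∀ {m k} {f g : Fin m → Fin k} → (∀ i → f i ≡ g i) → Fin.funToFin f ≡ Fin.funToFin g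
  funToFin-cong {zero}  e = ≡.refl
  funToFin-cong {suc m} e = ≡.cong₂ Fin.combine (e Fin.zero) (funToFin-cong (e ∘ Fin.suc))

  -- There are q ^ suc r coefficient vectors but only q ^ r values of Σ d t · w t.
  rows-in-small-span-dependent : ∀ {m n r} (M : Matrix m n) (D : Poly) (w : Fin m → Poly) →
    (∀ i → Vanishing r (w i)) → (∀ i j → coeff (w i ⊗ D) (toℕ j) ≈ M i j) →
    ∀ (s : Fin (suc r) → Fin m) → ¬ RowsIndependent M s
  rows-in-small-span-dependent {r = r} M D w w-small w-row s independent
    with Finₚ.pigeonhole (ℕₚ.^-monoʳ-< q 1<q (ℕₚ.n<1+n r)) (Fin.funToFin ∘ values)
    where
    values : Fin (q ℕ.^ suc r) → Fin r → Fin q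
    values x k = index (sumF (λ t → enum (Fin.finToFun x t) * coeff (w (s t)) (toℕ k)))
  ... | x , y , x<y , collision = ℕₚ.<⇒≢ x<y (≡.cong toℕ x≡y)
    where
    vector : Fin (q ℕ.^ suc r) → Fin (suc r) → Carrier
    vector x t = enum (Fin.finToFun x t)
    value : Fin (q ℕ.^ suc r) → ℕ → Carrier
    value x k = sumF (λ t → vector x t * coeff (w (s t)) k)
    d : Fin (suc r) → Carrier
    d t = vector x t - vector y t

    same-value : ∀ (k : Fin r) → value x (toℕ k) ≈ value y (toℕ k)
    same-value k = index-injective (≡.trans (≡.sym (Finₚ.finToFun-funToFin _ k))
      (≡.trans (≡.cong (λ c → Fin.finToFun c k) collision) (Finₚ.finToFun-funToFin _ k)))

    value-difference : ∀ k → sumF (λ t → d t * coeff (w (s t)) k) + value y k ≈ value x k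
    value-difference k = trans (sym (sumF-+ (λ t → d t * v t) (λ t → vector y t * v t)))
      (sumF-cong {f = λ t → d t * v t + vector y t * v t} {λ t → vector x t * v t} (λ t →
        trans (sym (distribʳ (v t) (d t) (vector y t))) (*-congʳ (trans (+-assoc _ _ _)
          (trans (+-congˡ (-‿inverseˡ _)) (+-identityʳ _))))))
      where
      v = λ t → coeff (w (s t)) k

    -- The collision speaks of the r recorded coefficients only; the higher ones vanish in every
    -- `w`.
    value-zero : ∀ k → sumF (λ t → d t * coeff (w (s t)) k) ≈ 0#
    value-zero k with k ℕ.<? r
    ... | no k≮r  = sumF-zero {f = λ t → d t * coeff (w (s t)) k}
      (λ t → trans (*-congˡ (w-small (s t) k (ℕₚ.≮⇒≥ k≮r))) (zeroʳ _))
    ... | yes k<r = ≡.subst (λ k → sumF (λ t → d t * coeff (w (s t)) k) ≈ 0#) (Finₚ.toℕ-fromℕ< k<r)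
      (cancel (trans (value-difference (toℕ (Fin.fromℕ< k<r))) (same-value (Fin.fromℕ< k<r))))
      where
      cancel : ∀ {x y} → x + y ≈ y → x ≈ 0#
      cancel {x} {y} e = trans (sym (trans (+-assoc _ _ _) (trans (+-congˡ (-‿inverseʳ y)) (+-identityʳ x))))
        (trans (+-congʳ e) (-‿inverseʳ y))

    combination : Poly
    combination = POps.sumF (λ t → constP (d t) ⊗ w (s t))

    combination≋𝟘 : combination ≋ 𝟘
    at combination≋𝟘 k = trans (coeff-sumF (λ t → constP (d t) ⊗ w (s t)) k)
      (trans (sumF-cong {f = λ t → coeff (constP (d t) ⊗ w (s t)) k} {λ t → d t * coeff (w (s t)) k}
        (λ t → coeff-constP⊗ (d t) (w (s t)) k))
      (trans (value-zero k) (sym (coeff-𝟘 k))))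

    -- Multiplying by D turns a relation between the cofactors into the same relation between the
    -- rows.
    combination-⊗D : combination ⊗ D ≋ POps.sumF (λ t → constP (d t) ⊗ (w (s t) ⊗ D))
    combination-⊗D = P.trans (P.*-comm combination D)
      (P.trans (PSums.*-sumF D (λ t → constP (d t) ⊗ w (s t)))
        (PSums.sumF-cong {f = λ t → D ⊗ (constP (d t) ⊗ w (s t))} {λ t → constP (d t) ⊗ (w (s t) ⊗ D)}
          (λ t → P.trans (P.*-comm _ _) (P.*-assoc _ _ _))))

    d-annihilates : ∀ j → sumF (λ t → d t * M (s t) j) ≈ 0#
    d-annihilates j = trans
      (sumF-cong {f = λ t → d t * M (s t) j} {λ t → coeff (constP (d t) ⊗ (w (s t) ⊗ D)) (toℕ j)}
        (λ t → trans (*-congˡ (sym (w-row (s t) j))) (sym (coeff-constP⊗ (d t) (w (s t) ⊗ D) (toℕ j)))))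
      (trans (sym (coeff-sumF (λ t → constP (d t) ⊗ (w (s t) ⊗ D)) (toℕ j)))
      (trans (sym (at combination-⊗D (toℕ j)))
      (trans (at (P.trans (P.*-congʳ combination≋𝟘) (P.zeroˡ D)) (toℕ j)) (coeff-𝟘 (toℕ j)))))

    x≡y : x ≡ y
    x≡y = ≡.trans (≡.sym (Finₚ.funToFin-finToFin {suc r} {q} x)) (≡.trans
      (funToFin-cong (λ t → enum-injective (x∙y⁻¹≈ε⇒x≈y _ _ (independent d d-annihilates t))))
      (Finₚ.funToFin-finToFin {suc r} {q} y))

  circulant-rank : ∀ {n} → 0 < n → (a : Fin n → Carrier) → ∀ {r} → r ≤ n → ∀ D → Monic (n ∸ r) D →
    D ∣ List.tabulate a → D ∣ xⁿ-1 n → (∀ e → e ∣ List.tabulate a → e ∣ xⁿ-1 n → e ∣ D) →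
    HasRank (circulant a) r
  circulant-rank 0<n a r≤n D monic-D D∣L D∣z greatest =
      ((λ i → inject≤ i r≤n) , leading-rows-independent 0<n a r≤n D monic-D greatest)
    , rows-in-small-span-dependent (circulant a) D (λ i → proj₁ (quotient i))
        (λ i → proj₁ (proj₂ (quotient i))) (λ i → proj₂ (proj₂ (quotient i)))
    where
    quotient = row-quotient 0<n a r≤n D monic-D D∣L D∣z

-- Transport of determinants and polynomials from F to K.

module Transfer {c ℓ c′ ℓ′} (F : Field c ℓ) (K : Field c′ ℓ′)
  (ι : Field.Carrier F → Field.Carrier K) (hom : IsRingHom F K ι) where
  private
    module F = Field F
    module K = Field K
    module OF = Ops F.commutativeRing
    module OK = Ops K.commutativeRing
    module PF = Polynomials F.commutativeRing
    module PK = Polynomials K.commutativeRing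
    module SK = Sums K.commutativeRing
  open RingMorphisms.IsRingHomomorphism hom
  open PK using (at; coeffwise)

  ι-sign : ∀ k → ι (OF.sign k) K.≈ OK.sign k
  ι-sign zero    = 1#-homo
  ι-sign (suc k) = K.trans (-‿homo _) (K.-‿cong (ι-sign k))

  ι-sumF : ∀ {k} (f : Fin k → F.Carrier) → ι (OF.sumF f) K.≈ OK.sumF (ι ∘ f)
  ι-sumF {zero}  f = 0#-homo
  ι-sumF {suc k} f = K.trans (+-homo _ _) (K.+-congˡ (ι-sumF (f ∘ Fin.suc)))

  ι-det : ∀ {k} (M : OF.Matrix k k) → ι (OF.det M) K.≈ OK.det (λ i j → ι (M i j))
  ι-det {zero}  M = 1#-homo
  ι-det {suc k} M = K.trans (ι-sumF (Determinants.laplace F.commutativeRing M))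
    (SK.sumF-cong {f = ι ∘ Determinants.laplace F.commutativeRing M}
        {Determinants.laplace K.commutativeRing (λ i j → ι (M i j))} (λ j →
      K.trans (*-homo _ _) (K.*-cong (ι-sign (toℕ j)) (K.trans (*-homo _ _)
        (K.*-congˡ (ι-det (λ i l → M (Fin.suc i) (punchIn j l))))))))

  coeff-map : ∀ p k → OK.coeff (map ι p) k K.≈ ι (OF.coeff p k)
  coeff-map []      k       = K.sym 0#-homo
  coeff-map (a ∷ p) zero    = K.refl
  coeff-map (a ∷ p) (suc k) = coeff-map p k

  map-cong : ∀ {p q} → p PF.≋ q → map ι p PK.≋ map ι q
  at (map-cong {p} {q} e) k =
    K.trans (coeff-map p k) (K.trans (⟦⟧-cong (PF.at e k)) (K.sym (coeff-map q k)))

  map-⊕ : ∀ p q → map ι (p PF.⊕ q) PK.≋ map ι p PK.⊕ map ι q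
  at (map-⊕ p q) k = K.trans (coeff-map (p PF.⊕ q) k) (K.trans (⟦⟧-cong (PF.coeff-⊕ p q k))
    (K.trans (+-homo _ _) (K.sym (K.trans (PK.coeff-⊕ (map ι p) (map ι q) k)
      (K.+-cong (coeff-map p k) (coeff-map q k))))))

  map-⊗ : ∀ p q → map ι (p PF.⊗ q) PK.≋ map ι p PK.⊗ map ι q
  map-⊗ p q rewrite PF.⊗≡*P p q | PK.⊗≡*P (map ι p) (map ι q) =
    coeffwise (λ k → K.trans (coeff-map (p OF.*P q) k) (K.sym (go p q k)))
    where
    map-tail : ∀ p → List.drop 1 (map ι p) ≡ map ι (List.drop 1 p)
    map-tail []      = ≡.refl
    map-tail (_ ∷ _) = ≡.refl
    go : ∀ p q k → OK.coeff (map ι p OK.*P map ι q) k K.≈ ι (OF.coeff (p OF.*P q) k)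
    go p q zero = K.trans (PK.coeff-*P-zero (map ι p) (map ι q)) (K.trans
      (K.*-cong (coeff-map p 0) (coeff-map q 0)) (K.trans (K.sym (*-homo _ _))
        (⟦⟧-cong (F.sym (PF.coeff-*P-zero p q)))))
    go p q (suc k) = K.trans (PK.coeff-*P-suc (map ι p) (map ι q) k) (K.trans
      (K.+-cong (K.trans (K.*-cong (coeff-map p 0) (coeff-map q (suc k))) (K.sym (*-homo _ _)))
        (K.trans (K.reflexive (≡.cong (λ t → OK.coeff (t OK.*P map ι q) k) (map-tail p)))
          (go (List.drop 1 p) q k)))
      (K.trans (K.sym (+-homo _ _)) (⟦⟧-cong (F.sym (PF.coeff-*P-suc p q k)))))

  map-xⁿ-1 : ∀ n → map ι (OF.xⁿ-1 n) PK.≋ OK.xⁿ-1 n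
  at (map-xⁿ-1 zero)    zero    = 0#-homo
  at (map-xⁿ-1 zero)    (suc k) = K.refl
  at (map-xⁿ-1 (suc n)) zero    = K.trans (-‿homo _) (K.-‿cong 1#-homo)
  at (map-xⁿ-1 (suc n)) (suc k) = go n k
    where
    go : ∀ n k → OK.coeff (map ι (List.replicate n F.0# List.++ (F.1# ∷ []))) k
      K.≈ OK.coeff (List.replicate n K.0# List.++ (K.1# ∷ [])) k
    go zero    zero    = 1#-homo
    go zero    (suc k) = K.refl
    go (suc n) zero    = 0#-homo
    go (suc n) (suc k) = go n k

  module _ (_≈?_ : ∀ x y → Dec (x F.≈ y)) where
    open import Algebra.Properties.Ring F.ring using (x∙y⁻¹≈ε⇒x≈y)
    open import Algebra.Properties.Ring K.ring using (x≈y⇒x∙y⁻¹≈ε)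

    -- A nonzero x would give 1 = ι(x) ι(x⁻¹) = 0 in K; deciding x = 0 in F turns this refutation
    -- into a proof.
    ι-kernel : ∀ x → ι x K.≈ K.0# → x F.≈ F.0#
    ι-kernel x e with x ≈? F.0#
    ... | yes x≈0 = x≈0
    ... | no x≉0  = contradiction (K.trans (K.sym 1#-homo) (K.trans (⟦⟧-cong (F.sym (F.inverseʳ x x≉0)))
      (K.trans (*-homo _ _) (K.trans (K.*-congʳ e) (K.zeroˡ _))))) K.1≉0

    ι-injective : ∀ x y → ι x K.≈ ι y → x F.≈ y
    ι-injective x y e = x∙y⁻¹≈ε⇒x≈y x y (ι-kernel _ (K.trans (+-homo _ _)
      (K.trans (K.+-congˡ (-‿homo y)) (x≈y⇒x∙y⁻¹≈ε e))))

    -- The degree of the gcd is visible only in K, through its linear factors, whereas the rank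
    -- argument takes place over F.
    monic-reflect : ∀ m p → Degrees.Monic K.commutativeRing m (map ι p) →
      Degrees.Monic F.commutativeRing m p
    monic-reflect m p (lead , small) =
        ι-injective _ _ (K.trans (K.sym (coeff-map p m)) (K.trans lead (K.sym 1#-homo)))
      , λ k m<k → ι-kernel _ (K.trans (K.sym (coeff-map p k)) (small k m<k))

-- The rank over F and the two determinant formulas over K.

theorem3p3 : ∀ {c ℓ c′ ℓ′} (q n : ℕ) → IsPrimePower q → 1 < n →
    (F : Field c ℓ) → HasSize F q →
    (K : Field c′ ℓ′) (ι : Field.Carrier F → Field.Carrier K) → IsAlgebraicClosure F K ι →
    let module F = Field F
        module K = Field K
        module PF = Ops F.commutativeRing
        module PK = Ops K.commutativeRing
    in
    (ω : Fin n → K.Carrier) →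
    (PK.xⁿ-1 n) PK.≈P (PK.prodP (λ i → PK.X PK.-P PK.constP (ω i))) →
    (a : Fin n → F.Carrier) → ¬ (∀ i → a i F.≈ F.0#) →
    (r : ℕ) → 0 < r → (r≤n : r ≤ n) →
    (D : PF.Poly) → PF.IsGCD D (L* F a) (PF.xⁿ-1 n) →
    (map ι D) PK.≈P (PK.prodP (λ t → PK.X PK.-P PK.constP (ω (upper r r≤n t)))) →
    (G : PF.Poly) → (L* F a) PF.≡ (G PF.*P D) [modP (PF.xⁿ-1 n) ] →
    PF.HasRank (M-L F q a) r
    × ι (PF.det (PF.leading r r≤n (M-L F q a)))
        K.≈ PK.prodF (λ j → (PK.pow (ω (inject≤ j r≤n)) r) K.⁻¹
                              K.* PK.eval (map ι G) (ω (inject≤ j r≤n)))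
    × (r ≡ n → ι (PF.det (M-L F q a)) K.≈ PK.prodF (λ j → PK.eval (map ι (L* F a)) (ω j)))
theorem3p3 q n _ 1<n F size K ι (hom , _) ω z≈∏ a _ r _ r≤n D (D∣L , D∣z , greatest) D≈∏ G L≡GD =
  rank , leading-determinant , λ _ → determinant
  where
  module F = Field F
  module K = Field K
  module OF = Ops F.commutativeRing
  module OK = Ops K.commutativeRing
  module PF = Polynomials F.commutativeRing
  module PK = Polynomials K.commutativeRing
  module FR = CommutativeRing PF.polyRing
  module KR = CommutativeRing PK.polyRing
  module SF = Sums F.commutativeRing
  module SK = Sums K.commutativeRing
  module CK = Circulants K.commutativeRing
  open Degrees K.commutativeRing using (Monic; linear; monic-prodP; monic-cong; monic-𝟙)
  open FiniteFields F q size using (frobenius-iterated; _≈?_)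
  open CirculantRank F q size using (circulant; circulant-rank; _∣_)
  open Transfer F K ι hom
  open RingMorphisms.IsRingHomomorphism hom using (⟦⟧-cong)
  open import Relation.Binary.Reasoning.Setoid K.setoid

  0<n : 0 < n
  0<n = ℕₚ.<⇒≤ 1<n

  zF = OF.xⁿ-1 n
  zK = OK.xⁿ-1 n
  L = List.tabulate a

  from-∣P : ∀ {d p} → d OF.∣P p → d ∣ p
  from-∣P {d} (e , ed≈p) = e , PF.coeffwise (λ k →
    ≡.subst (λ t → OF.coeff t k F.≈ _) (≡.sym (PF.⊗≡*P e d)) (ed≈p k))

  to-∣P : ∀ {d p} → d ∣ p → d OF.∣P p
  to-∣P {d} (e , ed≋p) = e , λ k →
    ≡.subst (λ t → OF.coeff t k F.≈ _) (PF.⊗≡*P e d) (PF.at ed≋p k)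

  M-L≈circulant : ∀ i j → M-L F q a i j F.≈ circulant a i j
  M-L≈circulant i j = frobenius-iterated (a (diffMod i j)) (toℕ i)

  ιD-monic : Monic (n ∸ r) (map ι D)
  ιD-monic = monic-cong {p = OK.prodP (λ t → linear (ω (upper r r≤n t)))} {map ι D}
    (KR.sym (PK.coeffwise D≈∏)) (monic-prodP (n ∸ r) (λ t → ω (upper r r≤n t)))

  rank : OF.HasRank (M-L F q a) r
  rank with circulant-rank 0<n a r≤n D (monic-reflect _≈?_ (n ∸ r) D ιD-monic)
    (from-∣P D∣L) (from-∣P D∣z) (λ e e∣L e∣z → from-∣P (greatest e (to-∣P e∣L) (to-∣P e∣z)))
  ... | (s , independent) , dependent =
      (s , λ coef e → independent coef (λ col → F.trans
        (SF.sumF-cong (λ t → F.*-congˡ (F.sym (M-L≈circulant (s t) col)))) (e col)))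
    , λ s′ indep → dependent s′ (λ coef e → indep coef (λ col → F.trans
        (SF.sumF-cong {f = λ t → coef t F.* M-L F q a (s′ t) col} {λ t → coef t F.* circulant a (s′ t) col}
          (λ t → F.*-congˡ (M-L≈circulant (s′ t) col))) (e col)))

  ι-leading : ∀ {k} (k≤n : k ≤ n) → ι (OF.det (OF.leading k k≤n (M-L F q a)))
    K.≈ OK.det (OK.leading k k≤n (λ i j → ι (a (diffMod i j))))
  ι-leading k≤n = K.trans (ι-det (OF.leading _ k≤n (M-L F q a)))
    (Determinants.det-cong K.commutativeRing
      (λ i j → ⟦⟧-cong (M-L≈circulant (inject≤ i k≤n) (inject≤ j k≤n))))

  factorisation : OK.prodP (λ j → linear (ω (inject≤ j r≤n))) PK.⊗ map ι D PK.≋ zK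
  factorisation = KR.trans (KR.*-congˡ (PK.coeffwise D≈∏)) (KR.sym (KR.trans (PK.coeffwise z≈∏)
    (PK.prodP-split r≤n (λ i → linear (ω i)))))

  Q = proj₁ L≡GD

  L≋GD+Qz : L PF.≋ G PF.⊗ D PF.⊕ Q PF.⊗ zF
  L≋GD+Qz = FR.sym (FR.trans (FR.+-congˡ (FR.trans (proj₂ (from-∣P L≡GD)) (difference L (G OF.*P D))))
    (FR.trans (FR.+-congʳ (FR.reflexive (PF.⊗≡*P G D))) (FR.trans (FR.+-comm _ _)
      (FR.trans (FR.+-assoc _ _ _) (FR.trans (FR.+-congˡ (FR.-‿inverseˡ _)) (FR.+-identityʳ _))))))
    where
    difference : ∀ p s → p OF.-P s PF.≋ p PF.⊕ PF.⊖ s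
    difference p s rewrite PF.⊖≡-P s | PF.⊕≡+P p (OF.-P s) = FR.refl

  ιL≋ : List.tabulate (ι ∘ a) PK.≋ map ι G PK.⊗ map ι D PK.⊕ map ι Q PK.⊗ zK
  ιL≋ = KR.trans (KR.reflexive (≡.sym (Listₚ.map-tabulate a ι))) (KR.trans (map-cong L≋GD+Qz)
    (KR.trans (map-⊕ (G PF.⊗ D) (Q PF.⊗ zF)) (KR.+-cong (map-⊗ G D)
      (KR.trans (map-⊗ Q zF) (KR.*-congˡ (map-xⁿ-1 n))))))

  leading-determinant : ι (OF.det (OF.leading r r≤n (M-L F q a)))
    K.≈ OK.prodF (λ j → (OK.pow (ω (inject≤ j r≤n)) r) K.⁻¹
                          K.* OK.eval (map ι G) (ω (inject≤ j r≤n)))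
  leading-determinant = begin
    ι (OF.det (OF.leading r r≤n (M-L F q a)))  ≈⟨ ι-leading r≤n ⟩
    OK.det (OK.leading r r≤n (λ i j → ι (a (diffMod i j))))
      ≈⟨ CK.leading-circulant-determinant r≤n (ι ∘ a) ω′ (map ι D) (map ι G) (map ι Q)
           (proj₂ ιD-monic) factorisation ιL≋ ⟩
    ∏G K.* d                                   ≈⟨ K.*-comm _ _ ⟩
    d K.* ∏G                                   ≈⟨ K.*-congʳ d≈∏⁻¹ ⟩
    OK.prodF (λ j → OK.pow (ω′ j) r K.⁻¹) K.* ∏G
      ≈⟨ SK.prodF-* (λ j → OK.pow (ω′ j) r K.⁻¹) (λ j → OK.eval (map ι G) (ω′ j)) ⟨
    OK.prodF (λ j → OK.pow (ω′ j) r K.⁻¹ K.* OK.eval (map ι G) (ω′ j)) ∎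
    where
    ω′ = λ j → ω (inject≤ j r≤n)
    ∏G = OK.prodF (λ j → OK.eval (map ι G) (ω′ j))
    d = OK.pow (OK.coeff (map ι D) 0) r
    ∏ω^r = OK.prodF (λ j → OK.pow (ω′ j) r)
    ∏⁻¹ = OK.prodF (λ j → OK.pow (ω′ j) r K.⁻¹)

    ∏ω^r*d≈1 : ∏ω^r K.* d K.≈ K.1#
    ∏ω^r*d≈1 = CK.constant-term-power 0<n ω′ (map ι D) factorisation

    -- The total inversion means something only at nonzero elements. A zero factor would make the
    -- product ∏ ω_j^r · d = 1 vanish.
    ω^r≉0 : ∀ j → ¬ (OK.pow (ω′ j) r K.≈ K.0#)
    ω^r≉0 j e = K.1≉0 (K.trans (K.sym ∏ω^r*d≈1)
      (K.trans (K.*-congʳ (SK.prodF-zero (λ j → OK.pow (ω′ j) r) j e)) (K.zeroˡ d)))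

    ∏ω^r*∏⁻¹≈1 : ∏ω^r K.* ∏⁻¹ K.≈ K.1#
    ∏ω^r*∏⁻¹≈1 = K.trans (K.sym (SK.prodF-* (λ j → OK.pow (ω′ j) r) (λ j → OK.pow (ω′ j) r K.⁻¹)))
      (SK.prodF-one (λ j → K.inverseʳ _ (ω^r≉0 j)))

    d≈∏⁻¹ : d K.≈ ∏⁻¹
    d≈∏⁻¹ = begin
      d                        ≈⟨ K.*-identityʳ d ⟨
      d K.* K.1#               ≈⟨ K.*-congˡ ∏ω^r*∏⁻¹≈1 ⟨
      d K.* (∏ω^r K.* ∏⁻¹)     ≈⟨ K.*-assoc _ _ _ ⟨
      d K.* ∏ω^r K.* ∏⁻¹       ≈⟨ K.*-congʳ (K.trans (K.*-comm _ _) ∏ω^r*d≈1) ⟩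
      K.1# K.* ∏⁻¹             ≈⟨ K.*-identityˡ _ ⟩
      ∏⁻¹                      ∎

  -- The same minor formula at full size, with the factorisation z = ∏ (x - ω_j) · 1, `G` = L* and
  -- no multiple of z: the constant term 1 contributes 1^n, so no inverse powers of the ω_j appear.
  determinant : ι (OF.det (M-L F q a)) K.≈ OK.prodF (λ j → OK.eval (map ι L) (ω j))
  determinant = begin
    ι (OF.det (M-L F q a))
      ≈⟨ ⟦⟧-cong (Determinants.det-cong F.commutativeRing (λ i j → F.reflexive (≡.cong₂ (M-L F q a)
           (≡.sym (Finₚ.inject≤-refl i ℕₚ.≤-refl)) (≡.sym (Finₚ.inject≤-refl j ℕₚ.≤-refl))))) ⟩
    ι (OF.det (OF.leading n ℕₚ.≤-refl (M-L F q a)))  ≈⟨ ι-leading ℕₚ.≤-refl ⟩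
    OK.det (OK.leading n ℕₚ.≤-refl (λ i j → ι (a (diffMod i j))))
      ≈⟨ CK.leading-circulant-determinant ℕₚ.≤-refl (ι ∘ a) ω (OK.constP K.1#) (map ι L) PK.𝟘
           (≡.subst (λ m → Degrees.Vanishing K.commutativeRing (suc m) (OK.constP K.1#))
             (≡.sym (ℕₚ.n∸n≡0 n)) (proj₂ monic-𝟙))
           (KR.trans (⊗1 _) (KR.sym (PK.coeffwise z≈∏)))
           (KR.trans (KR.reflexive (≡.sym (Listₚ.map-tabulate a ι))) (KR.sym (KR.trans
             (KR.+-cong (⊗1 _) (KR.zeroˡ zK)) (KR.+-identityʳ _)))) ⟩
    OK.prodF (λ j → OK.eval (map ι L) (ω j)) K.* OK.pow K.1# n
      ≈⟨ K.trans (K.*-congˡ (SK.pow-one n)) (K.*-identityʳ _) ⟩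
    OK.prodF (λ j → OK.eval (map ι L) (ω j)) ∎
    where
    ⊗1 : ∀ p → p PK.⊗ OK.constP K.1# PK.≋ p
    ⊗1 p = KR.trans (KR.*-congˡ (KR.reflexive (≡.sym PK.𝟙≡1))) (KR.*-identityʳ p)
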